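{- Let $n\ge 1$ and let $x_1,\dots,x_n,\lambda$ be indeterminates. Then \[\prod_{1\le i<j\le n}(x_i+\lambda x_j)=\sum_{\alpha\in Y_n(\{b,y,o,g\})}\lambda^{E(\alpha)}(1+\lambda)^{N(\alpha)}\prod_{k=1}^n x_k^{C_k(\alpha)-1}.\]
   Context: $Y_n(\{b,y,o,g\})$ is the set of integer arrays $\alpha=(\alpha_{i,j})$, $1\le i\le n$, $0\le j\le n-i$, with $i\le\alpha_{i,j}\le i+j$ and, whenever the entries involved are defined, $\alpha_{i,j}<\alpha_{i+1,j}$, $\alpha_{i,j}\le\alpha_{i,j+1}$, and $\alpha_{i,j}\le\alpha_{i+1,j-1}$. For an entry $\alpha_{i,j}$ with $j\ge1$, its southwest diagonal neighbor is $\alpha_{i+1,j-1}$ and its west neighbor is $\alpha_{i,j-1}$. $E(\alpha)$ is the number of entries $\alpha_{i,j}$ ($j\ge 1$) equal to their southwest diagonal neighbor; $N(\alpha)$ is the number of entries ($j\ge1$) strictly greater than their west neighbor and strictly less than their southwest diagonal neighbor; $C_k(\alpha)$ is the total number of entries of $\alpha$ (including column $0$) equal to $k$. -}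

module Defs where

open import Data.Nat using (ℕ; zero; suc; _+_; _∸_; _≡ᵇ_; _<ᵇ_)
open import Data.Bool using (Bool; true; false; _∧_; _∨_; not; if_then_else_)
open import Data.List using (List; []; _∷_; [_]; map; concatMap; upTo; foldr; filterᵇ; length)
open import Data.Bool.ListAction using (and)
open import Data.Maybe using (Maybe; just; nothing)
open import Data.Product using (_×_; _,_)
open import Algebra.Bundles using (CommutativeRing)

-- Arrays α = (α_{i,j}), 1 ≤ i ≤ n, 0 ≤ j ≤ n - i, represented as a list
-- of rows: the (i-1)-th element of the list is row i, a list of length
-- n - i + 1 whose j-th element (0-indexed) is α_{i,j}.

Array : Set
Array = List (List ℕ)

at : {A : Set} → List A → ℕ → Maybe A
at []       _       = nothing
at (a ∷ _)  zero    = just a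
at (_ ∷ as) (suc k) = at as k

-- α_{i,j} (i is 1-based, j is 0-based); nothing if undefined
entry : Array → ℕ → ℕ → Maybe ℕ
entry α zero    j = nothing
entry α (suc i) j with at α i
... | nothing = nothing
... | just r  = at r j

-- [a, a+1, ..., b]  (assuming a ≤ b)
range : ℕ → ℕ → List ℕ
range a b = map (a +_) (upTo (suc (b ∸ a)))

rowsFrom : (i j len : ℕ) → List (List ℕ)
rowsFrom i j zero      = [ [] ]
rowsFrom i j (suc len) =
  concatMap (λ v → map (v ∷_) (rowsFrom i (suc j) len)) (range i (i + j))

arraysFrom : (i k : ℕ) → List Array
arraysFrom i zero    = [ [] ]
arraysFrom i (suc k) =
  concatMap (λ r → map (r ∷_) (arraysFrom (suc i) k)) (rowsFrom i 0 (suc k))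

candidates : ℕ → List Array
candidates n = arraysFrom 1 n

positions : ℕ → List (ℕ × ℕ)
positions n =
  concatMap (λ i → map (λ j → (i , j)) (upTo (suc (n ∸ i)))) (map suc (upTo n))

_≤ᵇ'_ : ℕ → ℕ → Bool
a ≤ᵇ' b = (a <ᵇ b) ∨ (a ≡ᵇ b)

whenDef : (ℕ → ℕ → Bool) → Maybe ℕ → Maybe ℕ → Bool
whenDef R (just a) (just b) = R a b
whenDef R _        _        = true

condAt : Array → ℕ × ℕ → Bool
condAt α (i , j) =
  whenDef _<ᵇ_  (entry α i j) (entry α (suc i) j)
  ∧ whenDef _≤ᵇ'_ (entry α i j) (entry α i (suc j))
  ∧ southwest j
  where
    southwest : ℕ → Bool
    southwest zero    = true
    southwest (suc j') = whenDef _≤ᵇ'_ (entry α i j) (entry α (suc i) j')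

isY : ℕ → Array → Bool
isY n α = and (map (condAt α) (positions n))

Y : ℕ → List Array
Y n = filterᵇ (isY n) (candidates n)

countᵇ : {A : Set} → (A → Bool) → List A → ℕ
countᵇ p xs = length (filterᵇ p xs)

isE : Array → ℕ × ℕ → Bool
isE α (i , zero)   = false
isE α (i , suc j') = whenDefF _≡ᵇ_ (entry α i (suc j')) (entry α (suc i) j')
  where
    whenDefF : (ℕ → ℕ → Bool) → Maybe ℕ → Maybe ℕ → Bool
    whenDefF R (just a) (just b) = R a b
    whenDefF R _        _        = false

E : ℕ → Array → ℕ
E n α = countᵇ (isE α) (positions n)

isN : Array → ℕ × ℕ → Bool
isN α (i , zero)   = false
isN α (i , suc j') with entry α i j' | entry α i (suc j') | entry α (suc i) j'
... | just w | just a | just sw = (w <ᵇ a) ∧ (a <ᵇ sw)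
... | _      | _      | _       = false

N : ℕ → Array → ℕ
N n α = countᵇ (isN α) (positions n)

isC : Array → ℕ → ℕ × ℕ → Bool
isC α k (i , j) with entry α i j
... | just a  = a ≡ᵇ k
... | nothing = false

C : ℕ → Array → ℕ → ℕ
C n α k = countᵇ (isC α k) (positions n)

module _ {c ℓ} (R : CommutativeRing c ℓ) where
  open CommutativeRing R using (Carrier; 0#; 1#) renaming (_+_ to _+R_; _*_ to _*R_)

  pow : Carrier → ℕ → Carrier
  pow a zero    = 1#
  pow a (suc k) = a *R pow a k

  sumL : List Carrier → Carrier
  sumL = foldr _+R_ 0#

  prodL : List Carrier → Carrier
  prodL = foldr _*R_ 1#

  pairs : ℕ → List (ℕ × ℕ)
  pairs n = concatMap (λ j → map (λ i → (i , j)) (map suc (upTo (j ∸ 1)))) (map suc (upTo n))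

  LHS : ℕ → (ℕ → Carrier) → Carrier → Carrier
  LHS n x t = prodL (map (λ { (i , j) → x i +R (t *R x j) }) (pairs n))

  RHS : ℕ → (ℕ → Carrier) → Carrier → Carrier
  RHS n x t = sumL (map (λ α →
      (pow t (E n α) *R pow (1# +R t) (N n α))
        *R prodL (map (λ k → pow (x k) (C n α k ∸ 1)) (map suc (upTo n))))
    (Y n))

{-# OPTIONS --safe #-}
-- Read α by columns: column j + 1 interlaces column j, and the weights E, N, C split into a
-- weight of each transition c → d between consecutive columns. Let F(c) be the weighted sum over
-- all continuations of a strictly increasing column c. Then F(c) is the coefficient of
-- e₀ ∧ e₁ ∧ ⋯ in P_{c₁} ∧ P_{c₂} ∧ ⋯, where
--   P_s = ∏_{r < s} (1 + x_r z) ∏_{s < r ≤ n} (1 − λ x_r z)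
-- is read as a vector of coefficients in z. All P_s have constant term 1, so row reduction
-- replaces the factors by the (P_{c_{i+1}} − P_{c_i}) / z, and these telescope to sums of
-- x_d P_d over c_i ≤ d ≤ c_{i+1}, with coefficient 1 at c_i, λ at c_{i+1} and 1 + λ in between:
-- exactly the transition weights. Non-strict columns d drop out because the product alternates.
-- For the full column 1, …, n the same row reduction, iterated, is explicit: with
--   P^{(m)}_s = ∏_{r < s} (1 + x_r z) ∏_{s + m ≤ r ≤ n} (1 − λ x_r z)
-- one has P^{(m)}_{s+1} − P^{(m)}_s = (x_s + λ x_{s+m}) z P^{(m+1)}_s.
module Submission where

open import Defs
open import Data.Nat using (ℕ; zero; suc; _≤_; _<_; z≤n; s≤s; _∸_; _<ᵇ_; _≡ᵇ_)
import Data.Nat as ℕ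
import Data.Nat.Properties as ℕₚ
open import Data.Bool using (Bool; true; false; _∧_; if_then_else_; T)
open import Data.Bool.ListAction using (and)
open import Data.List using (List; []; _∷_; [_]; _++_; map; concatMap; upTo; foldr; filterᵇ; length; replicate)
import Data.List.Properties as Listₚ
open import Data.List.Relation.Unary.All using (All; []; _∷_)
open import Data.Maybe using (Maybe; just; nothing)
open import Data.Product using (_×_; _,_; proj₁; proj₂)
open import Function using (_∘_)
open import Algebra.Bundles using (CommutativeMonoid; CommutativeRing)
import Algebra.Properties.CommutativeSemigroup as CommutativeSemigroupProperties
import Algebra.Properties.Ring as RingProperties
import Algebra.Solver.Ring.NaturalCoefficients.Default as SemiringSolver
open import Relation.Binary.PropositionalEquality as ≡ using (_≡_)
import Relation.Binary.Reasoning.Setoid as SetoidReasoning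

-- Iterated operations over lists, ranges and triangles of positions

upTo-suc : ∀ n → upTo (suc n) ≡ 0 ∷ map suc (upTo n)
upTo-suc n = ≡.cong (0 ∷_) (≡.sym (Listₚ.map-upTo suc n))

module BigOp {c ℓ} (M : CommutativeMonoid c ℓ) where
  open CommutativeMonoid M
  open CommutativeSemigroupProperties commutativeSemigroup using (interchange)
  open SetoidReasoning setoid

  ⨀ : {A : Set} → (A → Carrier) → List A → Carrier
  ⨀ f xs = foldr _∙_ ε (map f xs)

  ⨀-cong : {A : Set} {f g : A → Carrier} → (∀ a → f a ≈ g a) → ∀ xs → ⨀ f xs ≈ ⨀ g xs
  ⨀-cong f≈g []       = refl
  ⨀-cong f≈g (x ∷ xs) = ∙-cong (f≈g x) (⨀-cong f≈g xs)

  ⨀-ε : {A : Set} {f : A → Carrier} → (∀ a → f a ≈ ε) → ∀ xs → ⨀ f xs ≈ ε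
  ⨀-ε f≈ε []       = refl
  ⨀-ε f≈ε (x ∷ xs) = trans (∙-cong (f≈ε x) (⨀-ε f≈ε xs)) (identityˡ ε)

  ⨀-∙ : {A : Set} (f g : A → Carrier) → ∀ xs → ⨀ (λ a → f a ∙ g a) xs ≈ ⨀ f xs ∙ ⨀ g xs
  ⨀-∙ f g []       = sym (identityˡ ε)
  ⨀-∙ f g (x ∷ xs) = trans (∙-congˡ (⨀-∙ f g xs)) (interchange _ _ _ _)

  ⨀-++ : {A : Set} (f : A → Carrier) → ∀ xs ys → ⨀ f (xs ++ ys) ≈ ⨀ f xs ∙ ⨀ f ys
  ⨀-++ f []       ys = sym (identityˡ _)
  ⨀-++ f (x ∷ xs) ys = trans (∙-congˡ (⨀-++ f xs ys)) (sym (assoc _ _ _))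

  ⨀-map : {A B : Set} (f : B → Carrier) (h : A → B) → ∀ xs → ⨀ f (map h xs) ≡ ⨀ (f ∘ h) xs
  ⨀-map f h xs = ≡.cong (foldr _∙_ ε) (≡.sym (Listₚ.map-∘ xs))

  ⨀-concatMap : {A B : Set} (f : B → Carrier) (h : A → List B) →
    ∀ xs → ⨀ f (concatMap h xs) ≈ ⨀ (λ a → ⨀ f (h a)) xs
  ⨀-concatMap f h []       = refl
  ⨀-concatMap f h (x ∷ xs) = trans (⨀-++ f (h x) _) (∙-congˡ (⨀-concatMap f h xs))

  ⨀-concatMap-map : {A B D : Set} (f : D → Carrier) (h : A → B → D) (ys : A → List B) →
    ∀ xs → ⨀ f (concatMap (λ a → map (h a) (ys a)) xs) ≈ ⨀ (λ a → ⨀ (f ∘ h a) (ys a)) xs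
  ⨀-concatMap-map f h ys xs =
    trans (⨀-concatMap f _ xs) (⨀-cong (λ a → reflexive (⨀-map f (h a) (ys a))) xs)

  ⨀-swap : {A B : Set} (f : A → B → Carrier) → ∀ xs ys →
    ⨀ (λ a → ⨀ (f a) ys) xs ≈ ⨀ (λ b → ⨀ (λ a → f a b) xs) ys
  ⨀-swap f []       ys = sym (⨀-ε (λ _ → refl) ys)
  ⨀-swap f (x ∷ xs) ys = trans (∙-congˡ (⨀-swap f xs ys)) (sym (⨀-∙ (f x) _ ys))

  ⨀-upTo-suc : ∀ (f : ℕ → Carrier) n → ⨀ f (upTo (suc n)) ≡ f 0 ∙ ⨀ (f ∘ suc) (upTo n)
  ⨀-upTo-suc f n = ≡.trans (≡.cong (⨀ f) (upTo-suc n)) (≡.cong (f 0 ∙_) (⨀-map f suc (upTo n)))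

  ⨀-upTo-snoc : ∀ (f : ℕ → Carrier) n → ⨀ f (upTo (suc n)) ≈ ⨀ f (upTo n) ∙ f n
  ⨀-upTo-snoc f n = begin
    ⨀ f (upTo (suc n))      ≡⟨ ≡.cong (⨀ f) (Listₚ.upTo-∷ʳ n) ⟨
    ⨀ f (upTo n ++ [ n ])   ≈⟨ ⨀-++ f (upTo n) [ n ] ⟩
    ⨀ f (upTo n) ∙ (f n ∙ ε) ≈⟨ ∙-congˡ (identityʳ (f n)) ⟩
    ⨀ f (upTo n) ∙ f n ∎

  ⨀-upTo-cong : ∀ {f g : ℕ → Carrier} n → (∀ i → i < n → f i ≈ g i) → ⨀ f (upTo n) ≈ ⨀ g (upTo n)
  ⨀-upTo-cong zero f≈g = refl
  ⨀-upTo-cong {f} {g} (suc n) f≈g = begin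
    ⨀ f (upTo (suc n))           ≡⟨ ⨀-upTo-suc f n ⟩
    f 0 ∙ ⨀ (f ∘ suc) (upTo n)   ≈⟨ ∙-cong (f≈g 0 (s≤s z≤n)) (⨀-upTo-cong n (λ i i<n → f≈g (suc i) (s≤s i<n))) ⟩
    g 0 ∙ ⨀ (g ∘ suc) (upTo n)   ≡⟨ ⨀-upTo-suc g n ⟨
    ⨀ g (upTo (suc n)) ∎

  -- Truncated subtraction gives `m ∸ i = suc (m ∸ suc i)` only for `i < m`, so the last index is
  -- split off.
  ⨀-upTo-∸ : ∀ (h : ℕ → ℕ → Carrier) m →
    ⨀ (λ i → h i (m ∸ i)) (upTo (suc m)) ≈ ⨀ (λ i → h i (suc (m ∸ suc i))) (upTo m) ∙ h m 0
  ⨀-upTo-∸ h zero    = comm _ _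
  ⨀-upTo-∸ h (suc m) = begin
    ⨀ (λ i → h i (suc m ∸ i)) (upTo (suc (suc m)))
      ≡⟨ ⨀-upTo-suc _ (suc m) ⟩
    h 0 (suc m) ∙ ⨀ (λ i → h (suc i) (m ∸ i)) (upTo (suc m))
      ≈⟨ ∙-congˡ (⨀-upTo-∸ (h ∘ suc) m) ⟩
    h 0 (suc m) ∙ (⨀ (λ i → h (suc i) (suc (m ∸ suc i))) (upTo m) ∙ h (suc m) 0)
      ≈⟨ assoc _ _ _ ⟨
    (h 0 (suc m) ∙ ⨀ (λ i → h (suc i) (suc (m ∸ suc i))) (upTo m)) ∙ h (suc m) 0
      ≡⟨ ≡.cong (_∙ h (suc m) 0) (⨀-upTo-suc (λ i → h i (suc (suc m ∸ suc i))) m) ⟨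
    ⨀ (λ i → h i (suc (suc m ∸ suc i))) (upTo (suc m)) ∙ h (suc m) 0 ∎

  ⨀-positions : ∀ (f : ℕ × ℕ → Carrier) m →
    ⨀ f (positions m) ≈ ⨀ (λ i → ⨀ (λ j → f (suc i , j)) (upTo (suc (m ∸ suc i)))) (upTo m)
  ⨀-positions f m = trans
    (⨀-concatMap-map f _,_ (λ i → upTo (suc (m ∸ i))) (map suc (upTo m)))
    (reflexive (⨀-map _ suc (upTo m)))

  -- Without column 0, the triangle of size `suc m` is the triangle of size `m` with its columns
  -- shifted by one, since row `suc m` becomes empty. All weights are split by columns in this way.
  ⨀-positions-suc : ∀ (f : ℕ × ℕ → Carrier) m →
    ⨀ f (positions (suc m)) ≈
    ⨀ (λ i → f (suc i , 0)) (upTo (suc m)) ∙ ⨀ (λ p → f (proj₁ p , suc (proj₂ p))) (positions m)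
  ⨀-positions-suc f m = begin
    ⨀ f (positions (suc m))
      ≈⟨ ⨀-positions f (suc m) ⟩
    ⨀ (λ i → ⨀ (λ j → f (suc i , j)) (upTo (suc (m ∸ i)))) (upTo (suc m))
      ≈⟨ ⨀-cong (λ i → reflexive (⨀-upTo-suc (λ j → f (suc i , j)) (m ∸ i))) (upTo (suc m)) ⟩
    ⨀ (λ i → f (suc i , 0) ∙ h i (m ∸ i)) (upTo (suc m))
      ≈⟨ ⨀-∙ (λ i → f (suc i , 0)) (λ i → h i (m ∸ i)) (upTo (suc m)) ⟩
    ⨀ (λ i → f (suc i , 0)) (upTo (suc m)) ∙ ⨀ (λ i → h i (m ∸ i)) (upTo (suc m))
      ≈⟨ ∙-congˡ (trans (⨀-upTo-∸ h m) (identityʳ _)) ⟩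
    ⨀ (λ i → f (suc i , 0)) (upTo (suc m)) ∙ ⨀ (λ i → h i (suc (m ∸ suc i))) (upTo m)
      ≈⟨ ∙-congˡ (⨀-positions (λ p → f (proj₁ p , suc (proj₂ p))) m) ⟨
    ⨀ (λ i → f (suc i , 0)) (upTo (suc m)) ∙ ⨀ (λ p → f (proj₁ p , suc (proj₂ p))) (positions m) ∎
    where
    h : ℕ → ℕ → Carrier
    h i l = ⨀ (λ j → f (suc i , suc j)) (upTo l)

-- Columns of an array and summation by columns

-- Entries of row i + r (r ≥ 0) of a column j: the bounds i + r ≤ α_{i+r,j} ≤ i + r + j.
data Column (i j : ℕ) : ℕ → List ℕ → Set where
  []  : Column i j 0 []
  _∷_ : ∀ {k v c} → i ≤ v × v ≤ i ℕ.+ j → Column (suc i) j k c → Column i j (suc k) (v ∷ c)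

length-column : ∀ {i j k c} → Column i j k c → length c ≡ k
length-column []      = ≡.refl
length-column (_ ∷ C) = ≡.cong suc (length-column C)

-- Unlike in `arraysFrom`, the rows may start at any column `j`, so that removing the first column
-- leaves arrays of the same kind.
arraysAt : (i j k : ℕ) → List Array
arraysAt i j zero    = [ [] ]
arraysAt i j (suc k) = concatMap (λ r → map (r ∷_) (arraysAt (suc i) j k)) (rowsFrom i j (suc k))

colsAt : (i j k : ℕ) → List (List ℕ)
colsAt i j zero    = [ [] ]
colsAt i j (suc k) = concatMap (λ v → map (v ∷_) (colsAt (suc i) j k)) (range i (i ℕ.+ j))

arraysFrom≡arraysAt : ∀ i k → arraysFrom i k ≡ arraysAt i 0 k
arraysFrom≡arraysAt i zero    = ≡.refl
arraysFrom≡arraysAt i (suc k) =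
  ≡.cong (λ A → concatMap (λ r → map (r ∷_) A) (rowsFrom i 0 (suc k))) (arraysFrom≡arraysAt (suc i) k)

range≡ : ∀ i j → range i (i ℕ.+ j) ≡ map (i ℕ.+_) (upTo (suc j))
range≡ i j = ≡.cong (λ d → map (i ℕ.+_) (upTo (suc d))) (ℕₚ.m+n∸m≡n i j)

-- In the sums below `c` has one entry more than `β` has rows: the last entry of `c` opens a row of
-- its own, hence the clause for an empty `β`.
zipcons : List ℕ → Array → Array
zipcons []      β       = []
zipcons (v ∷ c) []      = (v ∷ []) ∷ zipcons c []
zipcons (v ∷ c) (r ∷ β) = (v ∷ r) ∷ zipcons c β

entry-∷ : ∀ r α i j → entry (r ∷ α) (suc (suc i)) j ≡ entry α (suc i) j
entry-∷ r α i j with at α i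
... | nothing = ≡.refl
... | just _  = ≡.refl

entry-zipcons-0 : ∀ c β i → entry (zipcons c β) (suc i) 0 ≡ at c i
entry-zipcons-0 []      β       i       = ≡.refl
entry-zipcons-0 (v ∷ c) []      zero    = ≡.refl
entry-zipcons-0 (v ∷ c) []      (suc i) =
  ≡.trans (entry-∷ (v ∷ []) (zipcons c []) i 0) (entry-zipcons-0 c [] i)
entry-zipcons-0 (v ∷ c) (r ∷ β) zero    = ≡.refl
entry-zipcons-0 (v ∷ c) (r ∷ β) (suc i) =
  ≡.trans (entry-∷ (v ∷ r) (zipcons c β) i 0) (entry-zipcons-0 c β i)

-- The bound on the lengths keeps `zipcons` from cutting off rows of `β`.
entry-zipcons-suc : ∀ c β → length β ≤ length c → ∀ i j →
  entry (zipcons c β) i (suc j) ≡ entry β i j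
entry-zipcons-suc c       β       len zero j = ≡.refl
entry-zipcons-suc []      []      len (suc i) j = ≡.refl
entry-zipcons-suc (v ∷ c) []      len (suc zero) j = ≡.refl
entry-zipcons-suc (v ∷ c) []      len (suc (suc i)) j =
  ≡.trans (entry-∷ (v ∷ []) (zipcons c []) i (suc j)) (entry-zipcons-suc c [] z≤n (suc i) j)
entry-zipcons-suc (v ∷ c) (r ∷ β) len (suc zero) j = ≡.refl
entry-zipcons-suc (v ∷ c) (r ∷ β) (s≤s len) (suc (suc i)) j =
  ≡.trans (entry-∷ (v ∷ r) (zipcons c β) i (suc j))
    (≡.trans (entry-zipcons-suc c β len (suc i) j) (≡.sym (entry-∷ r β i j)))

module ColumnSums {c ℓ} (M : CommutativeMonoid c ℓ) where
  open CommutativeMonoid M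
  open BigOp M
  open SetoidReasoning setoid

  ⨀-range : ∀ (f : ℕ → Carrier) i j → ⨀ f (range i (i ℕ.+ j)) ≡ ⨀ (λ e → f (i ℕ.+ e)) (upTo (suc j))
  ⨀-range f i j = ≡.trans (≡.cong (⨀ f) (range≡ i j)) (⨀-map f (i ℕ.+_) (upTo (suc j)))

  ⨀-range-cong : ∀ {f g : ℕ → Carrier} i j → (∀ v → i ≤ v × v ≤ i ℕ.+ j → f v ≈ g v) →
    ⨀ f (range i (i ℕ.+ j)) ≈ ⨀ g (range i (i ℕ.+ j))
  ⨀-range-cong {f} {g} i j f≈g = begin
    ⨀ f (range i (i ℕ.+ j))               ≡⟨ ⨀-range f i j ⟩
    ⨀ (λ e → f (i ℕ.+ e)) (upTo (suc j))
      ≈⟨ ⨀-upTo-cong (suc j) (λ { e (s≤s e≤j) → f≈g (i ℕ.+ e) (ℕₚ.m≤m+n i e , ℕₚ.+-monoʳ-≤ i e≤j) }) ⟩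
    ⨀ (λ e → g (i ℕ.+ e)) (upTo (suc j))  ≡⟨ ⨀-range g i j ⟨
    ⨀ g (range i (i ℕ.+ j)) ∎

  ⨀-cols-suc : ∀ (f : List ℕ → Carrier) i j k →
    ⨀ f (colsAt i j (suc k)) ≈
    ⨀ (λ v → ⨀ (λ c → f (v ∷ c)) (colsAt (suc i) j k)) (range i (i ℕ.+ j))
  ⨀-cols-suc f i j k = ⨀-concatMap-map f _∷_ (λ _ → colsAt (suc i) j k) (range i (i ℕ.+ j))

  ⨀-cols-cong : ∀ {f g : List ℕ → Carrier} i j k → (∀ c → Column i j k c → f c ≈ g c) →
    ⨀ f (colsAt i j k) ≈ ⨀ g (colsAt i j k)
  ⨀-cols-cong i j zero    f≈g = ∙-congʳ (f≈g [] [])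
  ⨀-cols-cong {f} {g} i j (suc k) f≈g = begin
    ⨀ f (colsAt i j (suc k)) ≈⟨ ⨀-cols-suc f i j k ⟩
    _ ≈⟨ ⨀-range-cong i j (λ v b → ⨀-cols-cong (suc i) j k (λ c C → f≈g (v ∷ c) (b ∷ C))) ⟩
    _ ≈⟨ ⨀-cols-suc g i j k ⟨
    ⨀ g (colsAt i j (suc k)) ∎

  ⨀-rows-suc : ∀ (f : List ℕ → Carrier) i j k →
    ⨀ f (rowsFrom i j (suc k)) ≈
    ⨀ (λ v → ⨀ (λ r → f (v ∷ r)) (rowsFrom i (suc j) k)) (range i (i ℕ.+ j))
  ⨀-rows-suc f i j k = ⨀-concatMap-map f _∷_ (λ _ → rowsFrom i (suc j) k) (range i (i ℕ.+ j))

  ⨀-arrays-suc : ∀ (f : Array → Carrier) i j k →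
    ⨀ f (arraysAt i j (suc k)) ≈
    ⨀ (λ r → ⨀ (λ α → f (r ∷ α)) (arraysAt (suc i) j k)) (rowsFrom i j (suc k))
  ⨀-arrays-suc f i j k = ⨀-concatMap-map f _∷_ (λ _ → arraysAt (suc i) j k) (rowsFrom i j (suc k))

  ⨀-arrays-cong : ∀ {f g : Array → Carrier} i j k → (∀ α → length α ≡ k → f α ≈ g α) →
    ⨀ f (arraysAt i j k) ≈ ⨀ g (arraysAt i j k)
  ⨀-arrays-cong i j zero    f≈g = ∙-congʳ (f≈g [] ≡.refl)
  ⨀-arrays-cong {f} {g} i j (suc k) f≈g = begin
    ⨀ f (arraysAt i j (suc k)) ≈⟨ ⨀-arrays-suc f i j k ⟩
    _ ≈⟨ ⨀-cong (λ r → ⨀-arrays-cong (suc i) j k (λ α len → f≈g (r ∷ α) (≡.cong suc len)))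
           (rowsFrom i j (suc k)) ⟩
    _ ≈⟨ ⨀-arrays-suc g i j k ⟨
    ⨀ g (arraysAt i j (suc k)) ∎

  -- Induction on the rows: the first row is split into its first entry and its rest, the induction
  -- hypothesis treats the rows below, and the rest of the first row becomes the first row of the
  -- remaining array.
  ⨀-transpose : ∀ (f : Array → Carrier) i j k →
    ⨀ f (arraysAt i j (suc k)) ≈
    ⨀ (λ c → ⨀ (λ β → f (zipcons c β)) (arraysAt i (suc j) k)) (colsAt i j (suc k))
  ⨀-transpose f i j zero = begin
    ⨀ f (arraysAt i j 1) ≈⟨ ⨀-arrays-suc f i j 0 ⟩
    _ ≈⟨ ⨀-rows-suc _ i j 0 ⟩
    ⨀ (λ v → (f ((v ∷ []) ∷ []) ∙ ε) ∙ ε) (range i (i ℕ.+ j))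
      ≈⟨ ⨀-cols-suc _ i j 0 ⟨
    _ ∎
  ⨀-transpose f i j (suc k) = begin
    ⨀ f (arraysAt i j (2 ℕ.+ k)) ≈⟨ ⨀-arrays-suc f i j (suc k) ⟩
    _ ≈⟨ ⨀-rows-suc _ i j (suc k) ⟩
    ⨀ (λ v → ⨀ (λ r → ⨀ (λ α → f ((v ∷ r) ∷ α)) (arraysAt (suc i) j (suc k))) rows) vs
      ≈⟨ ⨀-cong (λ v → ⨀-cong (λ r → ⨀-transpose (λ α → f ((v ∷ r) ∷ α)) (suc i) j k) rows) vs ⟩
    ⨀ (λ v → ⨀ (λ r → ⨀ (λ c → ⨀ (λ β → f (zipcons (v ∷ c) (r ∷ β)))
        (arraysAt (suc i) (suc j) k)) cols) rows) vs
      -- The rest of the first row and the rest of the first column are chosen independently.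
      ≈⟨ ⨀-cong (λ v → ⨀-swap _ rows cols) vs ⟩
    ⨀ (λ v → ⨀ (λ c → ⨀ (λ r → ⨀ (λ β → f (zipcons (v ∷ c) (r ∷ β)))
        (arraysAt (suc i) (suc j) k)) rows) cols) vs
      ≈⟨ ⨀-cong (λ v → ⨀-cong (λ c → ⨀-arrays-suc (λ β → f (zipcons (v ∷ c) β)) i (suc j) k) cols) vs ⟨
    _ ≈⟨ ⨀-cols-suc _ i j (suc k) ⟨
    _ ∎
    where
    vs   = range i (i ℕ.+ j)
    rows = rowsFrom i (suc j) (suc k)
    cols = colsAt (suc i) j (suc k)

-- Exterior algebra on coefficient sequences

module Exterior {c ℓ} (R : CommutativeRing c ℓ) where
  open CommutativeRing R
  open RingProperties ring using (-1*x≈-x)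
  open SemiringSolver commutativeSemiring using (solve; _:=_; _:+_; _:*_; con)
  open BigOp +-commutativeMonoid using () renaming (⨀ to ∑)
  open BigOp *-commutativeMonoid using () renaming (⨀ to ∏)
  open SetoidReasoning setoid

  -- Negation is written ε * x, so that the semiring solver can treat ε as a variable.
  ε : Carrier
  ε = - 1#

  x+εx≈0 : ∀ x → x + ε * x ≈ 0#
  x+εx≈0 x = trans (+-congˡ (-1*x≈-x x)) (-‿inverseʳ x)

  ∑-*ˡ : ∀ {A : Set} x (f : A → Carrier) ys → ∑ (λ y → x * f y) ys ≈ x * ∑ f ys
  ∑-*ˡ x f []       = sym (zeroʳ x)
  ∑-*ˡ x f (y ∷ ys) = trans (+-congˡ (∑-*ˡ x f ys)) (sym (distribˡ x _ _))

  Seq Form : Set c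
  Seq  = ℕ → Carrier
  Form = List Bool → Carrier

  -- A sequence f stands for the vector ∑ₖ f(k) eₖ. A form is given by its coefficients
  -- at the wedges of those eₖ whose k-th bit is set.
  wedge : Seq → Form → Form
  wedge f w []           = 0#
  wedge f w (false ∷ bs) = wedge (f ∘ suc) (w ∘ (false ∷_)) bs
  wedge f w (true ∷ bs)  = f 0 * w (false ∷ bs) + ε * wedge (f ∘ suc) (w ∘ (true ∷_)) bs

  -- The unit of the exterior algebra, supported at the empty wedge. Positions beyond the end of a
  -- bit list count as unset.
  one : Form
  one []           = 1#
  one (false ∷ bs) = one bs
  one (true ∷ bs)  = 0#

  wedges : List Seq → Form
  wedges = foldr wedge one

  wedge-cong : ∀ {f g : Seq} {w v : Form} → (∀ k → f k ≈ g k) → (∀ bs → w bs ≈ v bs) →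
    ∀ bs → wedge f w bs ≈ wedge g v bs
  wedge-cong f≈g w≈v []           = refl
  wedge-cong f≈g w≈v (false ∷ bs) = wedge-cong (f≈g ∘ suc) (w≈v ∘ (false ∷_)) bs
  wedge-cong f≈g w≈v (true ∷ bs)  = +-cong (*-cong (f≈g 0) (w≈v (false ∷ bs)))
    (*-congˡ (wedge-cong (f≈g ∘ suc) (w≈v ∘ (true ∷_)) bs))

  wedge-congˡ : ∀ (f : Seq) {w v : Form} → (∀ bs → w bs ≈ v bs) → ∀ bs → wedge f w bs ≈ wedge f v bs
  wedge-congˡ f = wedge-cong (λ _ → refl)

  wedge-zeroˡ : ∀ {f : Seq} {w : Form} → (∀ k → f k ≈ 0#) → ∀ bs → wedge f w bs ≈ 0#
  wedge-zeroˡ f≈0 []           = refl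
  wedge-zeroˡ f≈0 (false ∷ bs) = wedge-zeroˡ (f≈0 ∘ suc) bs
  wedge-zeroˡ f≈0 (true ∷ bs)  = trans
    (+-cong (trans (*-congʳ (f≈0 0)) (zeroˡ _)) (trans (*-congˡ (wedge-zeroˡ (f≈0 ∘ suc) bs)) (zeroʳ ε)))
    (+-identityˡ 0#)

  wedge-zeroʳ : ∀ {f : Seq} {w : Form} → (∀ bs → w bs ≈ 0#) → ∀ bs → wedge f w bs ≈ 0#
  wedge-zeroʳ w≈0 []           = refl
  wedge-zeroʳ w≈0 (false ∷ bs) = wedge-zeroʳ (w≈0 ∘ (false ∷_)) bs
  wedge-zeroʳ {f} w≈0 (true ∷ bs)  = trans
    (+-cong (trans (*-congˡ (w≈0 (false ∷ bs))) (zeroʳ (f 0)))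
            (trans (*-congˡ (wedge-zeroʳ (w≈0 ∘ (true ∷_)) bs)) (zeroʳ ε)))
    (+-identityˡ 0#)

  -- Sum and multiple are combined in the shape of one step of a fold, so that linear combinations
  -- over a list follow by induction. A difference `ε * f k + g k` is a direct instance.
  wedge-linearˡ : ∀ a (f g : Seq) (w : Form) bs →
    wedge (λ k → a * f k + g k) w bs ≈ a * wedge f w bs + wedge g w bs
  wedge-linearˡ a f g w []           = solve 1 (λ a → con 0 := a :* con 0 :+ con 0) refl a
  wedge-linearˡ a f g w (false ∷ bs) = wedge-linearˡ a (f ∘ suc) (g ∘ suc) (w ∘ (false ∷_)) bs
  wedge-linearˡ a f g w (true ∷ bs)  = trans
    (+-congˡ (*-congˡ (wedge-linearˡ a (f ∘ suc) (g ∘ suc) (w ∘ (true ∷_)) bs)))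
    (solve 7 (λ a f₀ g₀ W e x y →
        (a :* f₀ :+ g₀) :* W :+ e :* (a :* x :+ y)
        := a :* (f₀ :* W :+ e :* x) :+ (g₀ :* W :+ e :* y))
      refl a (f 0) (g 0) _ ε _ _)

  wedge-linearʳ : ∀ a (f : Seq) (w v : Form) bs →
    wedge f (λ bs → a * w bs + v bs) bs ≈ a * wedge f w bs + wedge f v bs
  wedge-linearʳ a f w v []           = solve 1 (λ a → con 0 := a :* con 0 :+ con 0) refl a
  wedge-linearʳ a f w v (false ∷ bs) = wedge-linearʳ a (f ∘ suc) (w ∘ (false ∷_)) (v ∘ (false ∷_)) bs
  wedge-linearʳ a f w v (true ∷ bs)  = trans
    (+-congˡ (*-congˡ (wedge-linearʳ a (f ∘ suc) (w ∘ (true ∷_)) (v ∘ (true ∷_)) bs)))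
    (solve 7 (λ a f₀ W V e x y →
        f₀ :* (a :* W :+ V) :+ e :* (a :* x :+ y)
        := a :* (f₀ :* W :+ e :* x) :+ (f₀ :* V :+ e :* y))
      refl a (f 0) _ _ ε _ _)

  wedge-∑ˡ : ∀ {A : Set} (a : A → Carrier) (f : A → Seq) (w : Form) bs xs →
    wedge (λ k → ∑ (λ y → a y * f y k) xs) w bs ≈ ∑ (λ y → a y * wedge (f y) w bs) xs
  wedge-∑ˡ a f w bs []       = wedge-zeroˡ (λ _ → refl) bs
  wedge-∑ˡ a f w bs (x ∷ xs) = trans (wedge-linearˡ (a x) (f x) _ w bs) (+-congˡ (wedge-∑ˡ a f w bs xs))

  wedge-∑ʳ : ∀ {A : Set} (a : A → Carrier) (f : Seq) (w : A → Form) bs xs →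
    wedge f (λ bs → ∑ (λ y → a y * w y bs) xs) bs ≈ ∑ (λ y → a y * wedge f (w y) bs) xs
  wedge-∑ʳ a f w bs []       = wedge-zeroʳ (λ _ → refl) bs
  wedge-∑ʳ a f w bs (x ∷ xs) = trans (wedge-linearʳ (a x) f (w x) _ bs) (+-congˡ (wedge-∑ʳ a f w bs xs))

  wedge-*ˡ : ∀ a (f : Seq) (w : Form) bs → wedge (λ k → a * f k) w bs ≈ a * wedge f w bs
  wedge-*ˡ a f w bs = begin
    wedge (λ k → a * f k) w bs          ≈⟨ wedge-cong (λ k → sym (+-identityʳ _)) (λ _ → refl) bs ⟩
    wedge (λ k → a * f k + 0#) w bs     ≈⟨ wedge-linearˡ a f (λ _ → 0#) w bs ⟩
    a * wedge f w bs + wedge (λ _ → 0#) w bs ≈⟨ +-congˡ (wedge-zeroˡ (λ _ → refl) bs) ⟩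
    a * wedge f w bs + 0#               ≈⟨ +-identityʳ _ ⟩
    a * wedge f w bs ∎

  wedge-*ʳ : ∀ a (f : Seq) (w : Form) bs → wedge f (λ bs → a * w bs) bs ≈ a * wedge f w bs
  wedge-*ʳ a f w bs = begin
    wedge f (λ bs → a * w bs) bs        ≈⟨ wedge-congˡ f (λ _ → sym (+-identityʳ _)) bs ⟩
    wedge f (λ bs → a * w bs + 0#) bs   ≈⟨ wedge-linearʳ a f w (λ _ → 0#) bs ⟩
    a * wedge f w bs + wedge f (λ _ → 0#) bs ≈⟨ +-congˡ (wedge-zeroʳ (λ _ → refl) bs) ⟩
    a * wedge f w bs + 0#               ≈⟨ +-identityʳ _ ⟩
    a * wedge f w bs ∎

  -- When the first bit is set, e₀ comes from the outer `f`, from the inner `f` or from `w`. The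
  -- first two contributions differ by the sign `ε` and cancel; the third is again of the form f ∧ f
  -- ∧ w, for shifted sequences.
  wedge-alternating : ∀ (f : Seq) (w : Form) bs → wedge f (wedge f w) bs ≈ 0#
  wedge-alternating f w []           = refl
  wedge-alternating f w (false ∷ bs) = wedge-alternating (f ∘ suc) (w ∘ (false ∷_)) bs
  wedge-alternating f w (true ∷ bs)  = begin
    f 0 * X + ε * wedge (f ∘ suc) (λ bs → f 0 * w (false ∷ bs) + ε * wedge (f ∘ suc) (w ∘ (true ∷_)) bs) bs
      ≈⟨ +-congˡ (*-congˡ (wedge-linearʳ (f 0) (f ∘ suc) (w ∘ (false ∷_)) _ bs)) ⟩
    f 0 * X + ε * (f 0 * X + wedge (f ∘ suc) (λ bs → ε * wedge (f ∘ suc) (w ∘ (true ∷_)) bs) bs)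
      ≈⟨ +-congˡ (*-congˡ (+-congˡ (wedge-*ʳ ε (f ∘ suc) _ bs))) ⟩
    f 0 * X + ε * (f 0 * X + ε * wedge (f ∘ suc) (wedge (f ∘ suc) (w ∘ (true ∷_))) bs)
      ≈⟨ +-congˡ (*-congˡ (+-congˡ (trans (*-congˡ (wedge-alternating (f ∘ suc) (w ∘ (true ∷_)) bs)) (zeroʳ ε)))) ⟩
    f 0 * X + ε * (f 0 * X + 0#)
      ≈⟨ +-congˡ (*-congˡ (+-identityʳ _)) ⟩
    f 0 * X + ε * (f 0 * X)
      ≈⟨ x+εx≈0 _ ⟩
    0# ∎
    where X = wedge (f ∘ suc) (w ∘ (false ∷_)) bs

  -- The two sides differ by a multiple of f ∧ f ∧ w, which is zero.
  wedge-shear : ∀ (f g : Seq) (w : Form) bs →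
    wedge f (wedge g w) bs ≈ wedge f (wedge (λ k → ε * f k + g k) w) bs
  wedge-shear f g w bs = sym (begin
    wedge f (wedge (λ k → ε * f k + g k) w) bs
      ≈⟨ wedge-congˡ f (wedge-linearˡ ε f g w) bs ⟩
    wedge f (λ bs → ε * wedge f w bs + wedge g w bs) bs
      ≈⟨ wedge-linearʳ ε f (wedge f w) (wedge g w) bs ⟩
    ε * wedge f (wedge f w) bs + wedge f (wedge g w) bs
      ≈⟨ +-congʳ (trans (*-congˡ (wedge-alternating f w bs)) (zeroʳ ε)) ⟩
    0# + wedge f (wedge g w) bs
      ≈⟨ +-identityˡ _ ⟩
    wedge f (wedge g w) bs ∎)

  differences : List Seq → List Seq
  differences []           = []
  differences (f ∷ [])     = []
  differences (f ∷ g ∷ fs) = (λ k → ε * f k + g k) ∷ differences (g ∷ fs)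

  -- The tail is reduced first, so that each factor is sheared by a predecessor still in its
  -- original form.
  wedges-differences : ∀ f fs bs → wedges (f ∷ fs) bs ≈ wedge f (wedges (differences (f ∷ fs))) bs
  wedges-differences f []       bs = refl
  wedges-differences f (g ∷ fs) bs =
    trans (wedge-congˡ f (wedges-differences g fs) bs) (wedge-shear f g (wedges (differences (g ∷ fs))) bs)

  -- Without constant terms no factor can supply e₀.
  wedges-true : ∀ {fs} → All (λ (f : Seq) → f 0 ≈ 0#) fs → ∀ bs → wedges fs (true ∷ bs) ≈ 0#
  wedges-true []                       bs = refl
  wedges-true {f ∷ fs} (f₀≈0 ∷ fs₀≈0) bs = trans
    (+-cong (trans (*-congʳ f₀≈0) (zeroˡ _))
            (trans (*-congˡ (wedge-zeroʳ (wedges-true fs₀≈0) bs)) (zeroʳ ε)))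
    (+-identityˡ 0#)

  shifts : List Seq → List Seq
  shifts = map (_∘ suc)

  wedges-false : ∀ fs bs → wedges fs (false ∷ bs) ≈ wedges (shifts fs) bs
  wedges-false []       bs = refl
  wedges-false (f ∷ fs) bs = wedge-congˡ (f ∘ suc) (wedges-false fs) bs

  differences₀ : ∀ {fs} → All (λ (f : Seq) → f 0 ≈ 1#) fs → All (λ (f : Seq) → f 0 ≈ 0#) (differences fs)
  differences₀ []                      = []
  differences₀ (_ ∷ [])                = []
  differences₀ (f₀ ∷ (g₀ ∷ gs₀)) =
    trans (+-comm _ _) (trans (+-cong g₀ (*-congˡ f₀)) (x+εx≈0 1#)) ∷ differences₀ (g₀ ∷ gs₀)

  -- Row reduction: with all constant terms 1, the differences have constant term 0, and only
  -- the first factor involves e₀.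
  wedges-reduce : ∀ {f fs} → All (λ (f : Seq) → f 0 ≈ 1#) (f ∷ fs) → ∀ bs →
    wedges (f ∷ fs) (true ∷ bs) ≈ wedges (shifts (differences (f ∷ fs))) bs
  wedges-reduce {f} {fs} (f₀≈1 ∷ fs₀≈1) bs = begin
    wedges (f ∷ fs) (true ∷ bs)
      ≈⟨ wedges-differences f fs (true ∷ bs) ⟩
    f 0 * wedges ds (false ∷ bs) + ε * wedge (f ∘ suc) (wedges ds ∘ (true ∷_)) bs
      ≈⟨ +-cong (*-cong f₀≈1 (wedges-false ds bs))
                (*-congˡ (wedge-zeroʳ (wedges-true (differences₀ (f₀≈1 ∷ fs₀≈1))) bs)) ⟩
    1# * wedges (shifts ds) bs + ε * 0#
      ≈⟨ trans (+-cong (*-identityˡ _) (zeroʳ ε)) (+-identityʳ _) ⟩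
    wedges (shifts ds) bs ∎
    where ds = differences (f ∷ fs)

  wedges-scale : ∀ {A : Set} (a : A → Carrier) (f : A → Seq) xs bs →
    wedges (map (λ y k → a y * f y k) xs) bs ≈ ∏ a xs * wedges (map f xs) bs
  wedges-scale a f []       bs = sym (*-identityˡ _)
  wedges-scale a f (x ∷ xs) bs = begin
    wedge (λ k → a x * f x k) (wedges (map (λ y k → a y * f y k) xs)) bs
      ≈⟨ wedge-*ˡ (a x) (f x) _ bs ⟩
    a x * wedge (f x) (wedges (map (λ y k → a y * f y k) xs)) bs
      ≈⟨ *-congˡ (wedge-congˡ (f x) (wedges-scale a f xs) bs) ⟩
    a x * wedge (f x) (λ bs → ∏ a xs * wedges (map f xs) bs) bs
      ≈⟨ *-congˡ (wedge-*ʳ (∏ a xs) (f x) _ bs) ⟩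
    a x * (∏ a xs * wedge (f x) (wedges (map f xs)) bs)
      ≈⟨ *-assoc _ _ _ ⟨
    ∏ a (x ∷ xs) * wedges (map f (x ∷ xs)) bs ∎

  -- Multiplication of power series by 1 + a z.
  mulLin : Carrier → Seq → Seq
  mulLin a f zero    = f 0
  mulLin a f (suc k) = f (suc k) + a * f k

  mulLin-cong : ∀ a {f g : Seq} → (∀ k → f k ≈ g k) → ∀ k → mulLin a f k ≈ mulLin a g k
  mulLin-cong a f≈g zero    = f≈g 0
  mulLin-cong a f≈g (suc k) = +-cong (f≈g (suc k)) (*-congˡ (f≈g k))

  mulLin-comm : ∀ a b f k → mulLin a (mulLin b f) k ≈ mulLin b (mulLin a f) k
  mulLin-comm a b f zero = refl
  mulLin-comm a b f (suc zero) =
    solve 4 (λ a b x y → (x :+ b :* y) :+ a :* y := (x :+ a :* y) :+ b :* y) refl a b (f 1) (f 0)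
  mulLin-comm a b f (suc (suc k)) =
    solve 5 (λ a b x y z → (x :+ b :* y) :+ a :* (y :+ b :* z) := (x :+ a :* y) :+ b :* (y :+ a :* z))
      refl a b (f (suc (suc k))) (f (suc k)) (f k)

-- Consecutive integers, the series `P` and their differences

iota : ℕ → ℕ → List ℕ
iota s zero    = []
iota s (suc k) = s ∷ iota (suc s) k

iota≡ : ∀ s k → iota s k ≡ map (s ℕ.+_) (upTo k)
iota≡ s zero    = ≡.refl
iota≡ s (suc k) = ≡.sym (≡.trans (≡.cong (map (s ℕ.+_)) (upTo-suc k))
  (≡.cong₂ _∷_ (ℕₚ.+-identityʳ s) (≡.trans (≡.sym (Listₚ.map-∘ (upTo k)))
    (≡.trans (Listₚ.map-cong (ℕₚ.+-suc s) (upTo k)) (≡.sym (iota≡ (suc s) k))))))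

module Alternants {c ℓ} (R : CommutativeRing c ℓ) (X : ℕ → CommutativeRing.Carrier R)
                  (t : CommutativeRing.Carrier R) (n : ℕ) where
  open CommutativeRing R
  open SemiringSolver commutativeSemiring using (solve; _:=_; _:+_; _:*_; con)
  open BigOp +-commutativeMonoid
    using (⨀-cong; ⨀-ε; ⨀-upTo-suc) renaming (⨀ to ∑)
  open ColumnSums +-commutativeMonoid
    using () renaming (⨀-range to ∑-range; ⨀-cols-suc to ∑-cols-suc; ⨀-cols-cong to ∑-cols-cong)
  open BigOp *-commutativeMonoid using () renaming
    (⨀ to ∏; ⨀-cong to ∏-cong; ⨀-∙ to ∏-∙; ⨀-map to ∏-map;
     ⨀-upTo-suc to ∏-upTo-suc; ⨀-upTo-snoc to ∏-upTo-snoc)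
  open Exterior R
  open SetoidReasoning setoid

  -- The product starts at index 0. Column entries are at least 1 in the application, so the factor
  -- for 0 is common to all series that occur there.
  mulLow : ℕ → Seq → Seq
  mulLow zero    f = f
  mulLow (suc s) f = mulLin (X s) (mulLow s f)

  -- ∏_{q ≤ i < q + r} (1 − t X_i z)
  upper : ℕ → ℕ → Seq
  upper zero    q zero    = 1#
  upper zero    q (suc k) = 0#
  upper (suc r) q         = mulLin (ε * (t * X q)) (upper r (suc q))

  -- The coefficient sequence of ∏_{r < s} (1 + X_r z) ∏_{s + m ≤ r ≤ n} (1 − t X_r z).
  P : ℕ → ℕ → Seq
  P m s = mulLow s (upper (suc n ∸ (s ℕ.+ m)) (s ℕ.+ m))

  mulLow-cong : ∀ s {f g : Seq} → (∀ k → f k ≈ g k) → ∀ k → mulLow s f k ≈ mulLow s g k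
  mulLow-cong zero    f≈g = f≈g
  mulLow-cong (suc s) f≈g = mulLin-cong (X s) (mulLow-cong s f≈g)

  mulLow-mulLin : ∀ s a f k → mulLow s (mulLin a f) k ≈ mulLin a (mulLow s f) k
  mulLow-mulLin zero    a f k = refl
  mulLow-mulLin (suc s) a f k =
    trans (mulLin-cong (X s) (mulLow-mulLin s a f) k) (mulLin-comm (X s) a (mulLow s f) k)

  mulLow₀ : ∀ s f → mulLow s f 0 ≈ f 0
  mulLow₀ zero    f = refl
  mulLow₀ (suc s) f = mulLow₀ s f

  upper₀ : ∀ r q → upper r q 0 ≈ 1#
  upper₀ zero    q = refl
  upper₀ (suc r) q = upper₀ r (suc q)

  P₀ : ∀ m s → P m s 0 ≈ 1#
  P₀ m s = trans (mulLow₀ s _) (upper₀ (suc n ∸ (s ℕ.+ m)) (s ℕ.+ m))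

  -- The factor with the lowest index `s + m` is taken out of the upper product, which contains it
  -- because `s + m ≤ n`, and commuted past the lower product. With `P-right`, this makes `P m s`
  -- and `P m (suc s)` multiples of `P (suc m) s` by linear factors.
  P-left : ∀ m s → s ℕ.+ m ≤ n → ∀ k → P m s k ≈ mulLin (ε * (t * X (s ℕ.+ m))) (P (suc m) s) k
  P-left m s s+m≤n k rewrite ℕₚ.+-suc s m | ℕₚ.+-∸-assoc 1 s+m≤n =
    mulLow-mulLin s (ε * (t * X (s ℕ.+ m))) _ k

  P-right : ∀ m s k → P m (suc s) k ≈ mulLin (X s) (P (suc m) s) k
  P-right m s k rewrite ℕₚ.+-suc s m = refl

  -- The solver sees `ε` as a variable. Ring identities are therefore first arranged to end in a
  -- pair `y + ε * y`, which is then removed here.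
  cancel : ∀ x y → x + (y + ε * y) ≈ x
  cancel x y = trans (+-congˡ (x+εx≈0 y)) (+-identityʳ x)

  -- With Q = `P (suc m) s`, the two series are (1 - t X_{s+m} z) Q and (1 + X_s z) Q.
  P-difference : ∀ m s → s ℕ.+ m ≤ n → ∀ k →
    ε * P m s (suc k) + P m (suc s) (suc k) ≈ (X s + t * X (s ℕ.+ m)) * P (suc m) s k
  P-difference m s s+m≤n k = begin
    ε * P m s (suc k) + P m (suc s) (suc k)
      ≈⟨ +-cong (*-congˡ (P-left m s s+m≤n (suc k))) (P-right m s (suc k)) ⟩
    ε * (y₁ + (ε * u) * y₀) + (y₁ + X s * y₀)
      ≈⟨ solve 5 (λ e u a x y → e :* (y :+ (e :* u) :* x) :+ (y :+ a :* x)
            := ((a :+ e :* (e :* u)) :* x) :+ (y :+ e :* y)) refl ε u (X s) y₀ y₁ ⟩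
    ((X s + ε * (ε * u)) * y₀) + (y₁ + ε * y₁)
      ≈⟨ cancel _ y₁ ⟩
    (X s + ε * (ε * u)) * y₀
      ≈⟨ *-congʳ (+-congˡ εεu≈u) ⟩
    (X s + u) * y₀ ∎
    where
    u  = t * X (s ℕ.+ m)
    y₀ = P (suc m) s k
    y₁ = P (suc m) s (suc k)
    εεu≈u : ε * (ε * u) ≈ u
    εεu≈u = begin
      ε * (ε * u)             ≈⟨ cancel _ u ⟨
      ε * (ε * u) + (u + ε * u)
        ≈⟨ solve 2 (λ e u → e :* (e :* u) :+ (u :+ e :* u) := u :+ (e :* u :+ e :* (e :* u))) refl ε u ⟩
      u + (ε * u + ε * (ε * u)) ≈⟨ cancel u (ε * u) ⟩
      u ∎

  -- With Q = `P 2 s`, a = `X s` and b = `X (suc s)`, the series for `s` and `suc s` are (1 - t b z)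
  -- Q and (1 + a z) Q. In a (1 - t b z) + t b (1 + a z) the terms in z cancel, leaving the factor a
  -- + t b of their difference.
  P-step : ∀ s → s < n → ∀ k →
    P 1 (suc s) (suc k) ≈ P 1 s (suc k) + (X s * P 1 s k + t * (X (suc s) * P 1 (suc s) k))
  P-step s s<n k = begin
    P 1 (suc s) (suc k)
      ≈⟨ P-right 1 s (suc k) ⟩
    Q (suc k) + X s * Q k
      ≈⟨ eq k ⟨
    (Q (suc k) + (ε * u) * Q k) + (X s * mulLin (ε * u) Q k + t * (X (suc s) * mulLin (X s) Q k))
      ≈⟨ +-cong (P-left′ (suc k)) (+-cong (*-congˡ (P-left′ k)) (*-congˡ (*-congˡ (P-right 1 s k)))) ⟨
    P 1 s (suc k) + (X s * P 1 s k + t * (X (suc s) * P 1 (suc s) k)) ∎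
    where
    Q = P 2 s
    u = t * X (suc s)
    P-left′ : ∀ k → P 1 s k ≈ mulLin (ε * u) Q k
    P-left′ k = ≡.subst (λ r → P 1 s k ≈ mulLin (ε * (t * X r)) Q k) (ℕₚ.+-comm s 1)
      (P-left 1 s (≡.subst (_≤ n) (ℕₚ.+-comm 1 s) s<n) k)
    eq : ∀ k → (Q (suc k) + (ε * u) * Q k) + (X s * mulLin (ε * u) Q k + t * (X (suc s) * mulLin (X s) Q k))
             ≈ Q (suc k) + X s * Q k
    -- At `k = 0` the terms quadratic in z are absent, so the cancelling pair is shorter.
    eq zero = trans
      (solve 6 (λ e t b a x y →
          (y :+ (e :* (t :* b)) :* x) :+ (a :* x :+ t :* (b :* x))
          := (y :+ a :* x) :+ ((t :* b) :* x :+ e :* ((t :* b) :* x)))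
        refl ε t (X (suc s)) (X s) (Q 0) (Q 1))
      (cancel _ _)
    eq (suc k) = trans
      (solve 7 (λ e t b a x y z →
          (z :+ (e :* (t :* b)) :* y) :+ (a :* (y :+ (e :* (t :* b)) :* x) :+ t :* (b :* (y :+ a :* x)))
          := (z :+ a :* y) :+ (((t :* b) :* y :+ t :* b :* a :* x) :+ e :* ((t :* b) :* y :+ t :* b :* a :* x)))
        refl ε t (X (suc s)) (X s) (Q k) (Q (suc k)) (Q (suc (suc k))))
      (cancel _ _)

  -- Transition weights and their telescoping sums

  ind : Bool → Carrier
  ind b = if b then 1# else 0#

  sel : Bool → Carrier → Carrier
  sel b a = if b then a else 1#

  zero-term : ∀ {a b} → a ≈ 0# → a * b ≈ 0#
  zero-term a≈0 = trans (*-congʳ a≈0) (zeroˡ _)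

  -- The weight of an entry e whose west and southwest neighbours are a and b.
  ω : (a b e : ℕ) → Carrier
  ω a b e = ind (a ≤ᵇ' e) * (ind (e ≤ᵇ' b) * (sel (e ≡ᵇ b) t * sel ((a <ᵇ e) ∧ (e <ᵇ b)) (1# + t)))

  -- The comparisons in `ω` reduce under a common `suc`. This allows values to be replaced by their
  -- offsets from a lower bound.
  ω-shift : ∀ i a b e → ω (i ℕ.+ a) (i ℕ.+ b) (i ℕ.+ e) ≡ ω a b e
  ω-shift zero    a b e = ≡.refl
  ω-shift (suc i) a b e = ω-shift i a b e

  -- An inner point has weight 1 + t: its part `t * y 1` completes the step from `q 0` to `q 1`, and
  -- its other part `y 1` begins the next step, in the role of `y 0`.
  telescope₀ : ∀ L b (y q : ℕ → Carrier) → b < L →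
    (∀ e → e < suc b → q (suc e) ≈ q e + (y e + t * y (suc e))) →
    (y 0 + ∑ (λ e → ω 0 (suc b) (suc e) * y (suc e)) (upTo L)) + q 0 ≈ q (suc b)
  telescope₀ (suc L) zero y q (s≤s _) q-step = begin
    (y 0 + ∑ (λ e → ω 0 1 (suc e) * y (suc e)) (upTo (suc L))) + q 0
      ≈⟨ +-congʳ (+-congˡ (reflexive (⨀-upTo-suc (λ e → ω 0 1 (suc e) * y (suc e)) L))) ⟩
    (y 0 + ((1# * (1# * (t * 1#))) * y 1 + ∑ (λ e → ω 0 1 (suc (suc e)) * y (suc (suc e))) (upTo L))) + q 0
      -- Beyond the upper end every weight is 0.
      ≈⟨ +-congʳ (+-congˡ (+-congˡ (⨀-ε
           (λ e → zero-term (trans (*-identityˡ _) (zeroˡ _))) (upTo L)))) ⟩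
    (y 0 + ((1# * (1# * (t * 1#))) * y 1 + 0#)) + q 0
      ≈⟨ solve 4 (λ y₀ t y₁ q₀ → (y₀ :+ ((con 1 :* (con 1 :* (t :* con 1))) :* y₁ :+ con 0)) :+ q₀
            := q₀ :+ (y₀ :+ t :* y₁)) refl (y 0) t (y 1) (q 0) ⟩
    q 0 + (y 0 + t * y 1)
      ≈⟨ q-step 0 (s≤s z≤n) ⟨
    q 1 ∎
  telescope₀ (suc L) (suc b) y q (s≤s b<L) q-step = begin
    (y 0 + ∑ (λ e → ω 0 (suc (suc b)) (suc e) * y (suc e)) (upTo (suc L))) + q 0
      ≈⟨ +-congʳ (+-congˡ (reflexive (⨀-upTo-suc (λ e → ω 0 (suc (suc b)) (suc e) * y (suc e)) L))) ⟩
    (y 0 + ((1# * (1# * (1# * (1# + t)))) * y 1 + S)) + q 0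
      ≈⟨ solve 5 (λ y₀ t y₁ q₀ S → (y₀ :+ ((con 1 :* (con 1 :* (con 1 :* (con 1 :+ t)))) :* y₁ :+ S)) :+ q₀
            := (y₁ :+ S) :+ (q₀ :+ (y₀ :+ t :* y₁))) refl (y 0) t (y 1) (q 0) S ⟩
    (y 1 + S) + (q 0 + (y 0 + t * y 1))
      ≈⟨ +-congˡ (q-step 0 (s≤s z≤n)) ⟨
    (y 1 + S) + q 1
      ≈⟨ telescope₀ L b (y ∘ suc) (q ∘ suc) b<L (λ e e<b → q-step (suc e) (s≤s e<b)) ⟩
    q (suc (suc b)) ∎
    where S = ∑ (λ e → ω 0 (suc b) (suc e) * y (suc (suc e))) (upTo L)

  -- For a < b the weight ω a b is [a ≤ e < b] + t [a < e ≤ b], so the sum telescopes.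
  telescope : ∀ L a b (y q : ℕ → Carrier) → a < b → b < L →
    (∀ e → e < b → q (suc e) ≈ q e + (y e + t * y (suc e))) →
    ∑ (λ e → ω a b e * y e) (upTo L) + q a ≈ q b
  telescope (suc L) zero (suc b) y q a<b (s≤s b<L) q-step = begin
    ∑ (λ e → ω 0 (suc b) e * y e) (upTo (suc L)) + q 0
      ≈⟨ +-congʳ (reflexive (⨀-upTo-suc (λ e → ω 0 (suc b) e * y e) L)) ⟩
    ((1# * (1# * (1# * 1#))) * y 0 + ∑ (λ e → ω 0 (suc b) (suc e) * y (suc e)) (upTo L)) + q 0
      ≈⟨ +-congʳ (+-congʳ (solve 1 (λ y → (con 1 :* (con 1 :* (con 1 :* con 1))) :* y := y) refl (y 0))) ⟩
    (y 0 + ∑ (λ e → ω 0 (suc b) (suc e) * y (suc e)) (upTo L)) + q 0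
      ≈⟨ telescope₀ L b y q b<L q-step ⟩
    q (suc b) ∎
  telescope (suc L) (suc a) (suc b) y q (s≤s a<b) (s≤s b<L) q-step = begin
    ∑ (λ e → ω (suc a) (suc b) e * y e) (upTo (suc L)) + q (suc a)
      ≈⟨ +-congʳ (reflexive (⨀-upTo-suc (λ e → ω (suc a) (suc b) e * y e) L)) ⟩
    (ω (suc a) (suc b) 0 * y 0 + ∑ (λ e → ω a b e * y (suc e)) (upTo L)) + q (suc a)
      ≈⟨ +-congʳ (trans (+-congʳ (zero-term (zeroˡ _))) (+-identityˡ _)) ⟩
    ∑ (λ e → ω a b e * y (suc e)) (upTo L) + q (suc a)
      ≈⟨ telescope L a b (y ∘ suc) (q ∘ suc) a<b b<L (λ e e<b → q-step (suc e) (s≤s e<b)) ⟩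
    q (suc b) ∎

  -- Summing alternants over the next column

  increasing : List ℕ → Bool
  increasing (a ∷ b ∷ c) = (a <ᵇ b) ∧ increasing (b ∷ c)
  increasing _           = true

  -- The weight of the passage from a column `c` to the next column `d`, which is one entry shorter.
  -- Strictness is charged to `c` only; that of `d` belongs to the following passage.
  step : List ℕ → List ℕ → Carrier
  step (a ∷ b ∷ c) (e ∷ d) = (ind (a <ᵇ b) * (ω a b e * X e)) * step (b ∷ c) d
  step _           _       = 1#

  ind-∧ : ∀ a b → ind (a ∧ b) ≈ ind a * ind b
  ind-∧ true  b = sym (*-identityˡ _)
  ind-∧ false b = sym (zeroˡ _)

  alternant : List ℕ → Form
  alternant c = wedges (map (P 1) c)

  offset : ∀ {i j v} → i ≤ v × v ≤ i ℕ.+ j → v ≡ i ℕ.+ (v ∸ i) × v ∸ i ≤ j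
  offset {i} {j} {v} (i≤v , v≤i+j) =
    ≡.sym (ℕₚ.m+[n∸m]≡n i≤v) , ℕₚ.≤-trans (ℕₚ.∸-monoˡ-≤ i v≤i+j) (ℕₚ.≤-reflexive (ℕₚ.m+n∸m≡n i j))

  -- The range of `e` contains both `a` and `b`, so for `a < b` the sum over `e` telescopes from one
  -- to the other.
  step-sum : ∀ i j {a b} → i ≤ a × a ≤ i ℕ.+ j → suc i ≤ b × b ≤ suc i ℕ.+ j → b ≤ n → ∀ k →
    ∑ (λ e → (ind (a <ᵇ b) * (ω a b e * X e)) * P 1 e k) (range i (i ℕ.+ suc j)) ≈
    ind (a <ᵇ b) * (ε * P 1 a (suc k) + P 1 b (suc k))
  step-sum i j {a} {b} bdₐ (i<b , b≤) b≤n k with a <ᵇ b in eq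
  ... | false = trans (⨀-ε (λ e → zero-term (zeroˡ _)) (range i (i ℕ.+ suc j))) (sym (zeroˡ _))
  -- `b` lies one row lower; its bounds are restated relative to `i`, so that both offsets index the
  -- same range.
  ... | true with offset {i} {j} bdₐ
                | offset {i} {suc j} (ℕₚ.<⇒≤ i<b , ℕₚ.≤-trans b≤ (ℕₚ.≤-reflexive (≡.sym (ℕₚ.+-suc i j))))
  ... | a≡ , _ | b≡ , b'≤ = begin
    ∑ (λ e → (1# * (ω a b e * X e)) * P 1 e k) (range i (i ℕ.+ suc j))
      ≡⟨ ∑-range (λ e → (1# * (ω a b e * X e)) * P 1 e k) i (suc j) ⟩
    ∑ (λ e → (1# * (ω a b (i ℕ.+ e) * X (i ℕ.+ e))) * P 1 (i ℕ.+ e) k) (upTo (suc (suc j)))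
      ≈⟨ ⨀-cong (λ e → trans
           (solve 3 (λ w x p → (con 1 :* (w :* x)) :* p := w :* (x :* p)) refl _ _ _)
           (*-congʳ (reflexive (≡.trans (≡.cong₂ (λ a b → ω a b (i ℕ.+ e)) a≡ b≡) (ω-shift i a' b' e)))))
           (upTo (suc (suc j))) ⟩
    S
      ≈⟨ cancel S (q a') ⟨
    S + (q a' + ε * q a')
      ≈⟨ solve 3 (λ S q r → S :+ (q :+ r) := r :+ (S :+ q)) refl S (q a') (ε * q a') ⟩
    ε * q a' + (S + q a')
      ≈⟨ +-congˡ (telescope (suc (suc j)) a' b' y q a'<b' (s≤s b'≤) q-step) ⟩
    ε * q a' + q b'
      ≈⟨ reflexive (≡.cong₂ (λ a b → ε * P 1 a (suc k) + P 1 b (suc k)) (≡.sym a≡) (≡.sym b≡)) ⟩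
    ε * P 1 a (suc k) + P 1 b (suc k)
      ≈⟨ *-identityˡ _ ⟨
    1# * (ε * P 1 a (suc k) + P 1 b (suc k)) ∎
    where
    a' = a ∸ i
    b' = b ∸ i
    y q : ℕ → Carrier
    y e = X (i ℕ.+ e) * P 1 (i ℕ.+ e) k
    q e = P 1 (i ℕ.+ e) (suc k)
    S = ∑ (λ e → ω a' b' e * y e) (upTo (suc (suc j)))
    a'<b' : a' < b'
    a'<b' = ℕₚ.+-cancelˡ-< i a' b'
      (≡.subst₂ _<_ a≡ b≡ (ℕₚ.<ᵇ⇒< a b (≡.subst T (≡.sym eq) _)))
    q-step : ∀ e → e < b' → q (suc e) ≈ q e + (y e + t * y (suc e))
    q-step e e<b' rewrite ℕₚ.+-suc i e = P-step (i ℕ.+ e)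
      (ℕₚ.<-≤-trans (ℕₚ.+-monoʳ-< i e<b') (ℕₚ.≤-trans (ℕₚ.≤-reflexive (≡.sym b≡)) b≤n)) k

  -- Each entry of `d` is weighted only through two consecutive entries of `c`, so multilinearity
  -- turns the sum of wedges into a wedge of sums, each evaluated by `step-sum`. The bound
  -- `i + j + m ≤ n` keeps the entries of `c` where `P-step` applies.
  step-expansion : ∀ i j m {c} → Column i j (suc m) c → i ℕ.+ j ℕ.+ m ≤ n → ∀ bs →
    ∑ (λ d → step c d * alternant d bs) (colsAt i (suc j) m) ≈
    ind (increasing c) * wedges (shifts (differences (map (P 1) c))) bs
  step-expansion i j zero (_ ∷ []) _ bs = +-identityʳ _
  step-expansion i j (suc m) {a ∷ b ∷ c} (bdₐ ∷ C@(bd_b ∷ _)) le bs = begin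
    ∑ (λ d → step (a ∷ b ∷ c) d * alternant d bs) (colsAt i (suc j) (suc m))
      ≈⟨ ∑-cols-suc _ i (suc j) m ⟩
    ∑ (λ e → ∑ (λ d → (u e * step (b ∷ c) d) * wedge (P 1 e) (alternant d) bs) ds) es
      ≈⟨ ⨀-cong (λ e → trans (⨀-cong (λ d → *-assoc _ _ _) ds) (∑-*ˡ (u e) _ ds)) es ⟩
    ∑ (λ e → u e * ∑ (λ d → step (b ∷ c) d * wedge (P 1 e) (alternant d) bs) ds) es
      ≈⟨ ⨀-cong (λ e → *-congˡ (wedge-∑ʳ (step (b ∷ c)) (P 1 e) alternant bs ds)) es ⟨
    ∑ (λ e → u e * wedge (P 1 e) (λ bs → ∑ (λ d → step (b ∷ c) d * alternant d bs) ds) bs) es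
      ≈⟨ ⨀-cong (λ e → *-congˡ (trans
           (wedge-congˡ (P 1 e) (step-expansion (suc i) j m C le′) bs)
           (wedge-*ʳ (ind (increasing (b ∷ c))) (P 1 e) W bs))) es ⟩
    ∑ (λ e → u e * (ind (increasing (b ∷ c)) * wedge (P 1 e) W bs)) es
      ≈⟨ ⨀-cong (λ e → solve 3 (λ u i w → u :* (i :* w) := i :* (u :* w)) refl _ _ _) es ⟩
    ∑ (λ e → ind (increasing (b ∷ c)) * (u e * wedge (P 1 e) W bs)) es
      ≈⟨ ∑-*ˡ _ _ es ⟩
    ind (increasing (b ∷ c)) * ∑ (λ e → u e * wedge (P 1 e) W bs) es
      ≈⟨ *-congˡ (wedge-∑ˡ u (P 1) W bs es) ⟨
    ind (increasing (b ∷ c)) * wedge (λ k → ∑ (λ e → u e * P 1 e k) es) W bs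
      ≈⟨ *-congˡ (wedge-cong (step-sum i j bdₐ bd_b b≤n) (λ _ → refl) bs) ⟩
    ind (increasing (b ∷ c)) * wedge (λ k → ind (a <ᵇ b) * (ε * P 1 a (suc k) + P 1 b (suc k))) W bs
      ≈⟨ *-congˡ (wedge-*ˡ (ind (a <ᵇ b)) _ W bs) ⟩
    ind (increasing (b ∷ c)) * (ind (a <ᵇ b) * V)
      ≈⟨ solve 3 (λ i k v → i :* (k :* v) := (k :* i) :* v) refl _ _ V ⟩
    (ind (a <ᵇ b) * ind (increasing (b ∷ c))) * V
      ≈⟨ *-congʳ (ind-∧ (a <ᵇ b) (increasing (b ∷ c))) ⟨
    ind (increasing (a ∷ b ∷ c)) * V ∎
    where
    es = range i (i ℕ.+ suc j)
    ds = colsAt (suc i) (suc j) m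
    u : ℕ → Carrier
    u e = ind (a <ᵇ b) * (ω a b e * X e)
    W : Form
    W = wedges (shifts (differences (map (P 1) (b ∷ c))))
    V = wedge (λ k → ε * P 1 a (suc k) + P 1 b (suc k)) W bs
    le′ : suc i ℕ.+ j ℕ.+ m ≤ n
    le′ = ℕₚ.≤-trans (ℕₚ.≤-reflexive (≡.sym (ℕₚ.+-suc (i ℕ.+ j) m))) le
    b≤n : b ≤ n
    b≤n = ℕₚ.≤-trans (proj₂ bd_b) (ℕₚ.≤-trans (ℕₚ.m≤m+n _ m) le′)

  squeeze : ∀ e b e′ → (e ≤ᵇ' b) ≡ true → (b ≤ᵇ' e′) ≡ true → (e <ᵇ e′) ≡ false → e ≡ e′
  squeeze e b e′ e≤b b≤e′ e≮e′ = ℕₚ.≤-antisym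
    (ℕₚ.≤-trans (≤ᵇ'⇒≤ e b e≤b) (≤ᵇ'⇒≤ b e′ b≤e′))
    (ℕₚ.≮⇒≥ (λ e<e′ → ≡.subst T e≮e′ (ℕₚ.<⇒<ᵇ e<e′)))
    where
    ≤ᵇ'⇒≤ : ∀ a b → (a ≤ᵇ' b) ≡ true → a ≤ b
    ≤ᵇ'⇒≤ a b a≤b with a <ᵇ b in eq
    ... | true  = ℕₚ.<⇒≤ (ℕₚ.<ᵇ⇒< a b (≡.subst T (≡.sym eq) _))
    ... | false = ℕₚ.≤-reflexive (ℕₚ.≡ᵇ⇒≡ a b (≡.subst T (≡.sym a≤b) _))

  -- Interlacing leaves only e = b = e′ if e < e′ fails, and then two equal factors are wedged.
  nonincreasing-vanishes : ∀ a b b′ c e e′ d bs → (e <ᵇ e′) ≡ false →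
    step (a ∷ b ∷ b′ ∷ c) (e ∷ e′ ∷ d) * alternant (e ∷ e′ ∷ d) bs ≈ 0#
  nonincreasing-vanishes a b b′ c e e′ d bs e≮e′ with e ≤ᵇ' b in e≤b | b ≤ᵇ' e′ in b≤e′
  ... | false | _     = zero-term (zero-term (trans (*-congˡ (zero-term (trans (*-congˡ (zeroˡ _)) (zeroʳ _)))) (zeroʳ _)))
  ... | true  | false = zero-term (trans (*-congˡ (zero-term
                          (trans (*-congˡ (zero-term (zeroˡ _))) (zeroʳ _)))) (zeroʳ _))
  ... | true  | true  with squeeze e b e′ e≤b b≤e′ e≮e′
  ... | ≡.refl = trans (*-congˡ (wedge-alternating (P 1 e) (alternant d) bs)) (zeroʳ _)

  -- Used to insert the conjunction `increasing` one comparison at a time: where `p` fails, the term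
  -- was already 0.
  guard : ∀ p q {x z} → (p ≡ false → x * z ≈ 0#) → x * (ind q * z) ≈ x * z →
    x * (ind (p ∧ q) * z) ≈ x * z
  guard true  q vanish eq = eq
  guard false q vanish eq = trans (trans (*-congˡ (zeroˡ _)) (zeroʳ _)) (sym (vanish ≡.refl))

  -- Reconciles the strict columns of `Y` with `step-expansion`, which sums over all columns. The
  -- scalars of the tails are moved inside the leading wedge, where the induction hypothesis
  -- applies.
  step-increasing : ∀ {i j m c d} → Column i j (suc m) c → Column i (suc j) m d → ∀ bs →
    step c d * (ind (increasing d) * alternant d bs) ≈ step c d * alternant d bs
  step-increasing _ []       bs = *-congˡ (*-identityˡ _)
  step-increasing _ (_ ∷ []) bs = *-congˡ (*-identityˡ _)
  step-increasing {c = a ∷ b ∷ b′ ∷ c} {d = e ∷ e′ ∷ d} (_ ∷ C@(_ ∷ (_ ∷ _))) (_ ∷ D@(_ ∷ _)) bs =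
    guard (e <ᵇ e′) (increasing (e′ ∷ d)) (nonincreasing-vanishes a b b′ c e e′ d bs) (begin
    (u * S) * (I * wedge (P 1 e) W bs)
      ≈⟨ trans (*-congˡ (sym (wedge-*ʳ I (P 1 e) W bs))) (*-assoc _ _ _) ⟩
    u * (S * wedge (P 1 e) (λ bs → I * W bs) bs)
      ≈⟨ *-congˡ (wedge-*ʳ S (P 1 e) _ bs) ⟨
    u * wedge (P 1 e) (λ bs → S * (I * W bs)) bs
      ≈⟨ *-congˡ (wedge-congˡ (P 1 e) (step-increasing C D) bs) ⟩
    u * wedge (P 1 e) (λ bs → S * W bs) bs
      ≈⟨ *-congˡ (wedge-*ʳ S (P 1 e) W bs) ⟩
    u * (S * wedge (P 1 e) W bs)
      ≈⟨ *-assoc _ _ _ ⟨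
    (u * S) * wedge (P 1 e) W bs ∎)
    where
    u = ind (a <ᵇ b) * (ω a b e * X e)
    S = step (b ∷ b′ ∷ c) (e′ ∷ d)
    I = ind (increasing (e′ ∷ d))
    W = alternant (e′ ∷ d)

  P₀-all : ∀ m c → All (λ (f : Seq) → f 0 ≈ 1#) (map (P m) c)
  P₀-all m []      = []
  P₀-all m (s ∷ c) = P₀ m s ∷ P₀-all m c

  -- The recursion that the weighted sums over arrays also satisfy: passing to a longer column sets
  -- one more bit, and row reduction removes it again.
  alternant-step : ∀ i j m {c} → Column i j (suc m) c → i ℕ.+ j ℕ.+ m ≤ n → ∀ bs →
    ∑ (λ d → step c d * (ind (increasing d) * alternant d bs)) (colsAt i (suc j) m) ≈
    ind (increasing c) * alternant c (true ∷ bs)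
  alternant-step i j m {c@(_ ∷ c′)} C le bs = begin
    ∑ (λ d → step c d * (ind (increasing d) * alternant d bs)) (colsAt i (suc j) m)
      ≈⟨ ∑-cols-cong i (suc j) m (λ d D → step-increasing C D bs) ⟩
    ∑ (λ d → step c d * alternant d bs) (colsAt i (suc j) m)
      ≈⟨ step-expansion i j m C le bs ⟩
    ind (increasing c) * wedges (shifts (differences (map (P 1) c))) bs
      ≈⟨ *-congˡ (wedges-reduce (P₀-all 1 c) bs) ⟨
    ind (increasing c) * alternant c (true ∷ bs) ∎

  -- The alternant of the full column as a product over pairs

  diagonal : ℕ → ℕ → Carrier
  diagonal m s = X s + t * X (s ℕ.+ m)

  -- For consecutive indices each difference is a scalar multiple of a series of the next level, by
  -- `P-difference`.
  wedges-iota : ∀ m s k → s ℕ.+ k ℕ.+ m ≤ suc n → ∀ bs →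
    wedges (shifts (differences (map (P m) (iota s (suc k))))) bs ≈
    wedges (map (λ r k → diagonal m r * P (suc m) r k) (iota s k)) bs
  wedges-iota m s zero    le bs = refl
  wedges-iota m s (suc k) le bs = wedge-cong (P-difference m s s+m≤n) (wedges-iota m (suc s) k le′) bs
    where
    le′ : suc s ℕ.+ k ℕ.+ m ≤ suc n
    le′ = ≡.subst (λ r → r ℕ.+ m ≤ suc n) (ℕₚ.+-suc s k) le
    s+m≤n : s ℕ.+ m ≤ n
    s+m≤n = ℕₚ.≤-trans (ℕₚ.+-monoˡ-≤ m (ℕₚ.m≤m+n s k)) (ℕₚ.≤-pred le′)

  -- The factors are grouped by the distance of their two indices: distances m, m + 1, ...
  -- contribute k - 1, k - 2, ... factors.
  staircase : ℕ → ℕ → Carrier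
  staircase zero    m = 1#
  staircase (suc k) m = ∏ (diagonal m) (iota 1 k) * staircase k (suc m)

  -- Each row reduction uses up one bit and one series, extracts the factors of distance `m` and
  -- raises the level to `suc m`.
  wedges-staircase : ∀ k m → k ℕ.+ m ≤ suc n →
    wedges (map (P m) (iota 1 k)) (replicate k true) ≈ staircase k m
  wedges-staircase zero    m le = refl
  wedges-staircase (suc k) m le = begin
    wedges (map (P m) (iota 1 (suc k))) (true ∷ replicate k true)
      ≈⟨ wedges-reduce (P₀-all m (iota 1 (suc k))) _ ⟩
    wedges (shifts (differences (map (P m) (iota 1 (suc k))))) (replicate k true)
      ≈⟨ wedges-iota m 1 k le _ ⟩
    wedges (map (λ r k → diagonal m r * P (suc m) r k) (iota 1 k)) (replicate k true)
      ≈⟨ wedges-scale (diagonal m) (P (suc m)) (iota 1 k) _ ⟩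
    ∏ (diagonal m) (iota 1 k) * wedges (map (P (suc m)) (iota 1 k)) (replicate k true)
      ≈⟨ *-congˡ (wedges-staircase k (suc m) (≡.subst (_≤ suc n) (≡.sym (ℕₚ.+-suc k m)) le)) ⟩
    staircase (suc k) m ∎

  -- Regroups the factors by their larger index. By induction, the diagonal of distance `suc m`
  -- supplies the last factor of each row of the triangle.
  staircase-triangle : ∀ k m → staircase k (suc m) ≈
    ∏ (λ j → ∏ (λ i → X (suc i) + t * X (suc j ℕ.+ m)) (upTo j)) (upTo k)
  staircase-triangle zero    m = refl
  staircase-triangle (suc k) m = begin
    ∏ (diagonal (suc m)) (iota 1 k) * staircase k (suc (suc m))
      ≈⟨ *-cong (reflexive (≡.trans (≡.cong (∏ (diagonal (suc m))) (iota≡ 1 k))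
                                    (∏-map (diagonal (suc m)) suc (upTo k))))
                (staircase-triangle k (suc m)) ⟩
    ∏ (λ i → h i (suc i ℕ.+ suc m)) (upTo k) * ∏ (λ j → ∏ (λ i → h i (suc j ℕ.+ suc m)) (upTo j)) (upTo k)
      ≈⟨ *-comm _ _ ⟩
    ∏ (λ j → ∏ (λ i → h i (suc j ℕ.+ suc m)) (upTo j)) (upTo k) * ∏ (λ i → h i (suc i ℕ.+ suc m)) (upTo k)
      ≈⟨ ∏-∙ _ _ (upTo k) ⟨
    ∏ (λ j → ∏ (λ i → h i (suc j ℕ.+ suc m)) (upTo j) * h j (suc j ℕ.+ suc m)) (upTo k)
      ≈⟨ ∏-cong (λ j → trans
           (reflexive (≡.cong (λ r → ∏ (λ i → h i r) (upTo j) * h j r) (ℕₚ.+-suc (suc j) m)))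
           (sym (∏-upTo-snoc (λ i → h i (suc (suc j) ℕ.+ m)) j))) (upTo k) ⟩
    ∏ (λ j → ∏ (λ i → h i (suc (suc j) ℕ.+ m)) (upTo (suc j))) (upTo k)
      -- The factor 1 is the empty row `j = 0`.
      ≈⟨ *-identityˡ _ ⟨
    1# * ∏ (λ j → ∏ (λ i → h i (suc (suc j) ℕ.+ m)) (upTo (suc j))) (upTo k)
      ≡⟨ ∏-upTo-suc (λ j → ∏ (λ i → h i (suc j ℕ.+ m)) (upTo j)) k ⟨
    ∏ (λ j → ∏ (λ i → h i (suc j ℕ.+ m)) (upTo j)) (upTo (suc k)) ∎
    where
    h : ℕ → ℕ → Carrier
    h i r = X (suc i) + t * X r

-- Statistics of an array in terms of its entries, and column 0

length-zipcons : ∀ c β → length (zipcons c β) ≡ length c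
length-zipcons []      β       = ≡.refl
length-zipcons (v ∷ c) []      = ≡.cong suc (length-zipcons c [])
length-zipcons (v ∷ c) (r ∷ β) = ≡.cong suc (length-zipcons c β)

-- `equal` and `between` express the tests of `isE` and `isN` through the entries alone, so that
-- equations between entries can be rewritten in them.
equal : Maybe ℕ → Maybe ℕ → Bool
equal (just e) (just sw) = e ≡ᵇ sw
equal _        _         = false

between : Maybe ℕ → Maybe ℕ → Maybe ℕ → Bool
between (just w) (just e) (just sw) = (w <ᵇ e) ∧ (e <ᵇ sw)
between _        _        _         = false

isE-suc : ∀ α i j → isE α (i , suc j) ≡ equal (entry α i (suc j)) (entry α (suc i) j)
isE-suc α i j with entry α i (suc j) | entry α (suc i) j
... | just _  | just _  = ≡.refl
... | just _  | nothing = ≡.refl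
... | nothing | _       = ≡.refl

isN-suc : ∀ α i j → isN α (i , suc j) ≡ between (entry α i j) (entry α i (suc j)) (entry α (suc i) j)
isN-suc α i j with entry α i j | entry α i (suc j) | entry α (suc i) j
... | just _  | just _  | just _  = ≡.refl
... | just _  | just _  | nothing = ≡.refl
... | just _  | nothing | _       = ≡.refl
... | nothing | _       | _       = ≡.refl

isC-just : ∀ {α i j a} k → entry α i j ≡ just a → isC α k (i , j) ≡ (a ≡ᵇ k)
isC-just {α} {i} {j} k eq with entry α i j
isC-just k ≡.refl | just a = ≡.refl

isC-zipcons : ∀ c β k → length β ≤ length c → ∀ i j →
  isC (zipcons c β) k (i , suc j) ≡ isC β k (i , j)
isC-zipcons c β k len i j with entry (zipcons c β) i (suc j) | entry β i j | entry-zipcons-suc c β len i j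
... | just _  | _ | ≡.refl = ≡.refl
... | nothing | _ | ≡.refl = ≡.refl

length-iota : ∀ s k → length (iota s k) ≡ k
length-iota s zero    = ≡.refl
length-iota s (suc k) = ≡.cong suc (length-iota (suc s) k)

at-iota : ∀ s k i → i < k → at (iota s k) i ≡ just (i ℕ.+ s)
at-iota s (suc k) zero    _         = ≡.refl
at-iota s (suc k) (suc i) (s≤s i<k) =
  ≡.trans (at-iota (suc s) k i i<k) (≡.cong just (ℕₚ.+-suc i s))

-- In column 0 the lower and the upper bound coincide.
colsAt-0 : ∀ i k → colsAt i 0 k ≡ [ iota i k ]
colsAt-0 i zero    = ≡.refl
colsAt-0 i (suc k) rewrite ℕₚ.+-identityʳ i | ℕₚ.n∸n≡0 i | colsAt-0 (suc i) k = ≡.refl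

column-iota : ∀ i k → Column i 0 k (iota i k)
column-iota i zero    = []
column-iota i (suc k) = (ℕₚ.≤-refl , ℕₚ.m≤m+n i 0) ∷ column-iota (suc i) k

module ℕ+ = BigOp ℕₚ.+-0-commutativeMonoid

countᵇ≡sum : {A : Set} (p : A → Bool) → ∀ xs → countᵇ p xs ≡ ℕ+.⨀ (λ a → if p a then 1 else 0) xs
countᵇ≡sum p []       = ≡.refl
countᵇ≡sum p (x ∷ xs) with p x
... | true  = ≡.cong suc (countᵇ≡sum p xs)
... | false = countᵇ≡sum p xs

count-≡ : ∀ k n → k < n → ℕ+.⨀ (λ i → if i ≡ᵇ k then 1 else 0) (upTo n) ≡ 1
count-≡ zero    (suc n) _ = ≡.trans (ℕ+.⨀-upTo-suc (λ i → if i ≡ᵇ 0 then 1 else 0) n)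
  (≡.cong suc (ℕ+.⨀-ε (λ _ → ≡.refl) (upTo n)))
count-≡ (suc k) (suc n) (s≤s k<n) = ≡.trans (ℕ+.⨀-upTo-suc (λ i → if i ≡ᵇ suc k then 1 else 0) n)
  (count-≡ k n k<n)

-- Column 0 contains each of 1, ..., n exactly once, which explains the exponent `C ∸ 1`.
C-zipcons : ∀ m β → length β ≡ m → ∀ k → k < suc m →
  C (suc m) (zipcons (iota 1 (suc m)) β) (suc k) ≡ suc (C m β (suc k))
C-zipcons m β len k k<n = begin
  countᵇ (isC α (suc k)) (positions (suc m))
    ≡⟨ countᵇ≡sum (isC α (suc k)) (positions (suc m)) ⟩
  ℕ+.⨀ f (positions (suc m))
    ≡⟨ ℕ+.⨀-positions-suc f m ⟩
  ℕ+.⨀ (λ i → f (suc i , 0)) (upTo (suc m)) ℕ.+ ℕ+.⨀ (λ p → f (proj₁ p , suc (proj₂ p))) (positions m)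
    ≡⟨ ≡.cong₂ ℕ._+_
        (≡.trans (ℕ+.⨀-upTo-cong (suc m) column₀) (count-≡ k (suc m) k<n))
        (≡.trans (ℕ+.⨀-cong rest (positions m)) (≡.sym (countᵇ≡sum (isC β (suc k)) (positions m)))) ⟩
  suc (C m β (suc k)) ∎
  where
  open ≡.≡-Reasoning
  c₀ = iota 1 (suc m)
  α  = zipcons c₀ β
  f : ℕ × ℕ → ℕ
  f p = if isC α (suc k) p then 1 else 0
  column₀ : ∀ i → i < suc m → f (suc i , 0) ≡ (if i ≡ᵇ k then 1 else 0)
  column₀ i i<n = ≡.cong (if_then 1 else 0) (isC-just {α} {suc i} {0} (suc k)
    (≡.trans (entry-zipcons-0 c₀ β i)
      (≡.trans (at-iota 1 (suc m) i i<n) (≡.cong just (ℕₚ.+-comm i 1)))))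
  rest : ∀ p → f (proj₁ p , suc (proj₂ p)) ≡ (if isC β (suc k) p then 1 else 0)
  rest (i , j) = ≡.cong (if_then 1 else 0) (isC-zipcons c₀ β (suc k)
    (ℕₚ.≤-trans (ℕₚ.≤-reflexive len) (ℕₚ.≤-trans (ℕₚ.n≤1+n m) (ℕₚ.≤-reflexive (≡.sym (length-iota 1 (suc m)))))) i j)

-- Weights of arrays and the two sides of the identity

module Expansion {c ℓ} (R : CommutativeRing c ℓ) (x : ℕ → CommutativeRing.Carrier R)
                 (t : CommutativeRing.Carrier R) (m : ℕ) where
  open CommutativeRing R
  open SemiringSolver commutativeSemiring using (solve; _:=_; _:+_; _:*_; con)
  open BigOp +-commutativeMonoid using () renaming
    (⨀ to ∑; ⨀-cong to ∑-cong)
  open ColumnSums +-commutativeMonoid using () renaming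
    (⨀-cols-cong to ∑-cols-cong; ⨀-arrays-cong to ∑-arrays-cong; ⨀-transpose to ∑-transpose)
  open BigOp *-commutativeMonoid using () renaming
    (⨀ to ∏; ⨀-cong to ∏-cong; ⨀-ε to ∏-1; ⨀-∙ to ∏-∙; ⨀-map to ∏-map; ⨀-swap to ∏-swap;
     ⨀-upTo-suc to ∏-upTo-suc; ⨀-upTo-cong to ∏-upTo-cong; ⨀-concatMap-map to ∏-concatMap-map;
     ⨀-positions-suc to ∏-positions-suc)
  open SetoidReasoning setoid

  n : ℕ
  n = suc m

  indices : List ℕ
  indices = map suc (upTo n)

  -- Equal to x on 1, …, n; as a product over k it lets ∏ₖ x_k^{C_k} be regrouped by entries.
  X : ℕ → Carrier
  X a = ∏ (λ k → if a ≡ᵇ k then x k else 1#) indices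

  open Exterior R using (∑-*ˡ; wedges-reduce)
  open Alternants R X t n

  ∏-delta : ∀ (f : ℕ → Carrier) i n → i < n → ∏ (λ k → sel (i ≡ᵇ k) (f k)) (upTo n) ≈ f i
  ∏-delta f zero (suc n) _ = begin
    _ ≡⟨ ∏-upTo-suc (λ k → sel (0 ≡ᵇ k) (f k)) n ⟩
    f 0 * ∏ (λ _ → 1#) (upTo n) ≈⟨ *-congˡ (∏-1 (λ _ → refl) (upTo n)) ⟩
    f 0 * 1# ≈⟨ *-identityʳ _ ⟩
    f 0 ∎
  ∏-delta f (suc i) (suc n) (s≤s i<n) = begin
    _ ≡⟨ ∏-upTo-suc (λ k → sel (suc i ≡ᵇ k) (f k)) n ⟩
    1# * ∏ (λ k → sel (i ≡ᵇ k) (f (suc k))) (upTo n) ≈⟨ *-identityˡ _ ⟩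
    ∏ (λ k → sel (i ≡ᵇ k) (f (suc k))) (upTo n) ≈⟨ ∏-delta (f ∘ suc) i n i<n ⟩
    f (suc i) ∎

  X≈x : ∀ i → i < n → X (suc i) ≈ x (suc i)
  X≈x i i<n = trans (reflexive (∏-map (λ k → sel (suc i ≡ᵇ k) (x k)) suc (upTo n)))
                    (∏-delta (x ∘ suc) i n i<n)

  Xᵐ : Maybe ℕ → Carrier
  Xᵐ (just a) = X a
  Xᵐ nothing  = 1#

  -- The conditions to the south and east form the frame of an entry; everything involving its
  -- southwest neighbour, together with its variable, forms its turn. Frames in one column and turns
  -- in the next then make up the weight of a passage between the two columns.
  frameᵐ : (here south east : Maybe ℕ) → Carrier
  frameᵐ h s e = ind (whenDef _<ᵇ_ h s) * ind (whenDef _≤ᵇ'_ h e)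

  turnᵐ : (west here southwest : Maybe ℕ) → Carrier
  turnᵐ w h sw =
    ind (whenDef _≤ᵇ'_ h sw) * ((sel (equal h sw) t * sel (between w h sw) (1# + t)) * Xᵐ h)

  frame turn : Array → ℕ × ℕ → Carrier
  frame α (i , j) = frameᵐ (entry α i j) (entry α (suc i) j) (entry α i (suc j))
  turn α (i , zero)  = 1#
  turn α (i , suc j) = turnᵐ (entry α i j) (entry α i (suc j)) (entry α (suc i) j)

  weight : ℕ → Array → Carrier
  weight k α = ∏ (frame α) (positions k) * ∏ (turn α) (positions k)

  frame-zipcons : ∀ c β k → length β ≤ length c →
    ∏ (frame (zipcons c β)) (positions (suc k)) ≈
    ∏ (λ i → frameᵐ (at c i) (at c (suc i)) (entry β (suc i) 0)) (upTo (suc k)) * ∏ (frame β) (positions k)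
  frame-zipcons c β k len = trans (∏-positions-suc (frame (zipcons c β)) k) (*-cong
    (∏-cong (λ i → reflexive (column₀ i)) (upTo (suc k)))
    (∏-cong (λ { (i , j) → reflexive (rest i j) }) (positions k)))
    where
    column₀ : ∀ i → frame (zipcons c β) (suc i , 0) ≡ frameᵐ (at c i) (at c (suc i)) (entry β (suc i) 0)
    column₀ i rewrite entry-zipcons-0 c β i | entry-zipcons-0 c β (suc i)
                    | entry-zipcons-suc c β len (suc i) 0 = ≡.refl
    rest : ∀ i j → frame (zipcons c β) (i , suc j) ≡ frame β (i , j)
    rest i j rewrite entry-zipcons-suc c β len i j | entry-zipcons-suc c β len (suc i) j
                   | entry-zipcons-suc c β len i (suc j) = ≡.refl

  turn-zipcons : ∀ c β k → length β ≤ length c →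
    ∏ (turn (zipcons c β)) (positions (suc k)) ≈
    ∏ (λ i → turnᵐ (at c i) (entry β (suc i) 0) (at c (suc i))) (upTo k) * ∏ (turn β) (positions k)
  -- A single column has no turns.
  turn-zipcons c β zero len = refl
  turn-zipcons c β (suc k) len = begin
    ∏ (turn (zipcons c β)) (positions (suc (suc k)))
      ≈⟨ no-turn (zipcons c β) (suc k) ⟩
    ∏ (λ p → turn (zipcons c β) (proj₁ p , suc (proj₂ p))) (positions (suc k))
      ≈⟨ ∏-positions-suc (λ p → turn (zipcons c β) (proj₁ p , suc (proj₂ p))) k ⟩
    ∏ (λ i → turn (zipcons c β) (suc i , 1)) (upTo (suc k)) *
    ∏ (λ p → turn (zipcons c β) (proj₁ p , suc (suc (proj₂ p)))) (positions k)
      ≈⟨ *-cong (∏-cong (λ i → reflexive (column₁ i)) (upTo (suc k)))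
                (trans (∏-cong (λ { (i , j) → reflexive (rest i j) }) (positions k)) (sym (no-turn β k))) ⟩
    ∏ (λ i → turnᵐ (at c i) (entry β (suc i) 0) (at c (suc i))) (upTo (suc k)) *
    ∏ (turn β) (positions (suc k)) ∎
    where
    no-turn : ∀ α k →
      ∏ (turn α) (positions (suc k)) ≈ ∏ (λ p → turn α (proj₁ p , suc (proj₂ p))) (positions k)
    no-turn α k = trans (∏-positions-suc (turn α) k)
      (trans (*-congʳ (∏-1 (λ _ → refl) (upTo (suc k)))) (*-identityˡ _))
    column₁ : ∀ i → turn (zipcons c β) (suc i , 1) ≡ turnᵐ (at c i) (entry β (suc i) 0) (at c (suc i))
    column₁ i rewrite entry-zipcons-0 c β i | entry-zipcons-0 c β (suc i)
                    | entry-zipcons-suc c β len (suc i) 0 = ≡.refl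
    rest : ∀ i j → turn (zipcons c β) (i , suc (suc j)) ≡ turn β (i , suc j)
    rest i j rewrite entry-zipcons-suc c β len i j | entry-zipcons-suc c β len (suc i) j
                   | entry-zipcons-suc c β len i (suc j) = ≡.refl

  -- Row by row the factors regroup to those of `step`. The last entry of `c` has no neighbour to
  -- the south or east, so its frame is 1.
  step-product : ∀ {i j k c d} → Column i j (suc k) c → Column i (suc j) k d →
    ∏ (λ i → frameᵐ (at c i) (at c (suc i)) (at d i)) (upTo (suc k)) *
    ∏ (λ i → turnᵐ (at c i) (at d i) (at c (suc i))) (upTo k) ≈ step c d
  step-product (_ ∷ []) [] =
    solve 0 (((con 1 :* con 1) :* con 1) :* con 1 := con 1) refl
  step-product {k = suc k} {a ∷ c@(b ∷ _)} {e ∷ d} (_ ∷ C@(_ ∷ _)) (_ ∷ D) = begin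
    ∏ fs (upTo (suc (suc k))) * ∏ ts (upTo (suc k))
      ≡⟨ ≡.cong₂ _*_ (∏-upTo-suc fs (suc k)) (∏-upTo-suc ts k) ⟩
    (fs 0 * ∏ (fs ∘ suc) (upTo (suc k))) * (ts 0 * ∏ (ts ∘ suc) (upTo k))
      ≈⟨ solve 8 (λ p q r s u v F T →
           ((p :* q) :* F) :* ((r :* ((s :* u) :* v)) :* T)
           := (p :* ((q :* (r :* (s :* u))) :* v)) :* (F :* T))
         refl (ind (a <ᵇ b)) (ind (a ≤ᵇ' e)) (ind (e ≤ᵇ' b)) (sel (e ≡ᵇ b) t)
           (sel ((a <ᵇ e) ∧ (e <ᵇ b)) (1# + t)) (X e) _ _ ⟩
    (ind (a <ᵇ b) * (ω a b e * X e)) * (∏ (fs ∘ suc) (upTo (suc k)) * ∏ (ts ∘ suc) (upTo k))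
      ≈⟨ *-congˡ (step-product C D) ⟩
    step (a ∷ c) (e ∷ d) ∎
    where
    fs ts : ℕ → Carrier
    fs i = frameᵐ (at (a ∷ c) i) (at (a ∷ c) (suc i)) (at (e ∷ d) i)
    ts i = turnᵐ (at (a ∷ c) i) (at (e ∷ d) i) (at (a ∷ c) (suc i))

  -- Removing the column `c` removes the frames of `c` and the turns of the next column. These see
  -- `β` only through its first column `d`.
  weight-zipcons : ∀ {i j k c d} → Column i j (suc k) c → Column i (suc j) k d →
    ∀ β → length β ≡ k → (∀ i → entry β (suc i) 0 ≡ at d i) →
    weight (suc k) (zipcons c β) ≈ step c d * weight k β
  weight-zipcons {k = k} {c} {d} C D β len first = begin
    weight (suc k) (zipcons c β)
      ≈⟨ *-cong (frame-zipcons c β k len′) (turn-zipcons c β k len′) ⟩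
    (∏ (λ i → frameᵐ (at c i) (at c (suc i)) (entry β (suc i) 0)) (upTo (suc k)) * ∏ (frame β) (positions k)) *
    (∏ (λ i → turnᵐ (at c i) (entry β (suc i) 0) (at c (suc i))) (upTo k) * ∏ (turn β) (positions k))
      ≈⟨ solve 4 (λ a b c d → (a :* b) :* (c :* d) := (a :* c) :* (b :* d)) refl _ _ _ _ ⟩
    (∏ (λ i → frameᵐ (at c i) (at c (suc i)) (entry β (suc i) 0)) (upTo (suc k)) *
     ∏ (λ i → turnᵐ (at c i) (entry β (suc i) 0) (at c (suc i))) (upTo k)) * weight k β
      ≈⟨ *-congʳ (trans (*-cong
           (∏-cong (λ i → reflexive (≡.cong (frameᵐ (at c i) (at c (suc i))) (first i))) (upTo (suc k)))
           (∏-cong (λ i → reflexive (≡.cong (λ e → turnᵐ (at c i) e (at c (suc i))) (first i))) (upTo k)))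
           (step-product C D)) ⟩
    step c d * weight k β ∎
    where
    len′ : length β ≤ length c
    len′ = ≡.subst₂ _≤_ (≡.sym len) (≡.sym (length-column C)) (ℕₚ.n≤1+n k)

  -- Induction on the number `k` of columns still to come: the next column is exposed by
  -- transposition, its passage weight splits off, and the induction hypothesis leaves the sum of
  -- `alternant-step`.
  weight-sum : ∀ j k {c} → Column 1 j (suc k) c → 1 ℕ.+ j ℕ.+ k ≤ n →
    ∑ (λ β → weight (suc k) (zipcons c β)) (arraysAt 1 (suc j) k) ≈
    ind (increasing c) * alternant c (replicate (suc k) true)
  weight-sum j zero {c@(_ ∷ [])} C@(_ ∷ []) le = begin
    weight 1 (zipcons c []) + 0#   ≈⟨ +-identityʳ _ ⟩
    weight 1 (zipcons c [])        ≈⟨ weight-zipcons C [] [] ≡.refl (λ _ → ≡.refl) ⟩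
    1# * (1# * 1#)                 ≈⟨ *-congˡ (*-identityˡ 1#) ⟩
    -- For one factor there are no differences; its coefficient at e₀ is the constant term 1.
    1# * 1#                        ≈⟨ *-congˡ (wedges-reduce (P₀-all 1 c) []) ⟨
    1# * alternant c (true ∷ []) ∎
  weight-sum j (suc k) {c} C le = begin
    ∑ (λ β → weight (2 ℕ.+ k) (zipcons c β)) (arraysAt 1 (suc j) (suc k))
      ≈⟨ ∑-transpose _ 1 (suc j) k ⟩
    ∑ (λ d → ∑ (λ β → weight (2 ℕ.+ k) (zipcons c (zipcons d β))) (arraysAt 1 (2 ℕ.+ j) k)) cols
      ≈⟨ ∑-cols-cong 1 (suc j) (suc k) (λ d D → trans
           (∑-cong (λ β → weight-zipcons C D (zipcons d β)
              (≡.trans (length-zipcons d β) (length-column D)) (entry-zipcons-0 d β))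
              (arraysAt 1 (2 ℕ.+ j) k))
           (trans (∑-*ˡ (step c d) _ (arraysAt 1 (2 ℕ.+ j) k))
                  (*-congˡ (weight-sum (suc j) k D (≡.subst (_≤ n) (ℕₚ.+-suc (1 ℕ.+ j) k) le))))) ⟩
    ∑ (λ d → step c d * (ind (increasing d) * alternant d (replicate (suc k) true))) cols
      ≈⟨ alternant-step 1 j (suc k) C le (replicate (suc k) true) ⟩
    ind (increasing c) * alternant c (replicate (2 ℕ.+ k) true) ∎
    where cols = colsAt 1 (suc j) (suc k)

  southwest : Array → ℕ × ℕ → Carrier
  southwest α (i , zero)  = 1#
  southwest α (i , suc j) = ind (whenDef _≤ᵇ'_ (entry α i (suc j)) (entry α (suc i) j))

  -- Column 0 contributes no variable, in accordance with the exponents `C ∸ 1`.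
  monomial : Array → ℕ × ℕ → Carrier
  monomial α (i , zero)  = 1#
  monomial α (i , suc j) = Xᵐ (entry α i (suc j))

  ind-condAt : ∀ α p → ind (condAt α p) ≈ frame α p * southwest α p
  ind-condAt α (i , zero)  = trans (ind-∧ (whenDef _<ᵇ_ (entry α i 0) (entry α (suc i) 0)) _)
    (trans (*-congˡ (ind-∧ (whenDef _≤ᵇ'_ (entry α i 0) (entry α i 1)) _)) (sym (*-assoc _ _ _)))
  ind-condAt α (i , suc j) = trans (ind-∧ (whenDef _<ᵇ_ (entry α i (suc j)) (entry α (suc i) (suc j))) _)
    (trans (*-congˡ (ind-∧ (whenDef _≤ᵇ'_ (entry α i (suc j)) (entry α i (suc (suc j)))) _))
           (sym (*-assoc _ _ _)))

  ind-and : {A : Set} (p : A → Bool) → ∀ ys → ind (and (map p ys)) ≈ ∏ (ind ∘ p) ys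
  ind-and p []       = refl
  ind-and p (y ∷ ys) = trans (ind-∧ (p y) _) (*-congˡ (ind-and p ys))

  pow-countᵇ : {A : Set} (a : Carrier) (p : A → Bool) → ∀ ys →
    pow R a (countᵇ p ys) ≈ ∏ (λ y → sel (p y) a) ys
  pow-countᵇ a p []       = refl
  pow-countᵇ a p (y ∷ ys) with p y
  ... | true  = *-congˡ (pow-countᵇ a p ys)
  ... | false = trans (pow-countᵇ a p ys) (sym (*-identityˡ _))

  turn-factors : ∀ α p →
    southwest α p * ((sel (isE α p) t * sel (isN α p) (1# + t)) * monomial α p) ≈ turn α p
  turn-factors α (i , zero)  = solve 0 (con 1 :* ((con 1 :* con 1) :* con 1) := con 1) refl
  turn-factors α (i , suc j) rewrite isE-suc α i j | isN-suc α i j = refl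

  ∏-isC : ∀ α p → ∏ (λ k → sel (isC α k p) (x k)) indices ≈ Xᵐ (entry α (proj₁ p) (proj₂ p))
  ∏-isC α (i , j) with entry α i j
  ... | just a  = refl
  ... | nothing = ∏-1 (λ _ → refl) indices

  -- After column 0 has absorbed the `∸ 1`, the exponents count positions of `β`. Exchanging the
  -- products over values and positions leaves one variable per position.
  ∏-monomial : ∀ β → length β ≡ m → let α = zipcons (iota 1 n) β in
    ∏ (λ k → pow R (x k) (C n α k ∸ 1)) indices ≈ ∏ (monomial α) (positions n)
  ∏-monomial β len = begin
    ∏ (λ k → pow R (x k) (C n α k ∸ 1)) indices
      ≡⟨ ∏-map (λ k → pow R (x k) (C n α k ∸ 1)) suc (upTo n) ⟩
    ∏ (λ k → pow R (x (suc k)) (C n α (suc k) ∸ 1)) (upTo n)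
      ≈⟨ ∏-upTo-cong n (λ k k<n → reflexive
           (≡.cong (λ e → pow R (x (suc k)) (e ∸ 1)) (C-zipcons m β len k k<n))) ⟩
    ∏ (λ k → pow R (x (suc k)) (C m β (suc k))) (upTo n)
      ≡⟨ ∏-map (λ k → pow R (x k) (C m β k)) suc (upTo n) ⟨
    ∏ (λ k → pow R (x k) (C m β k)) indices
      ≈⟨ ∏-cong (λ k → pow-countᵇ (x k) (isC β k) (positions m)) indices ⟩
    ∏ (λ k → ∏ (λ p → sel (isC β k p) (x k)) (positions m)) indices
      ≈⟨ ∏-swap (λ k p → sel (isC β k p) (x k)) indices (positions m) ⟩
    ∏ (λ p → ∏ (λ k → sel (isC β k p) (x k)) indices) (positions m)
      ≈⟨ ∏-cong (λ { (i , j) → trans (∏-isC β (i , j))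
           (reflexive (≡.cong Xᵐ (≡.sym (entry-zipcons-suc (iota 1 n) β len′ i j)))) }) (positions m) ⟩
    ∏ (λ p → monomial α (proj₁ p , suc (proj₂ p))) (positions m)
      ≈⟨ trans (*-congʳ (∏-1 (λ _ → refl) (upTo n))) (*-identityˡ _) ⟨
    ∏ (λ i → 1#) (upTo n) * ∏ (λ p → monomial α (proj₁ p , suc (proj₂ p))) (positions m)
      ≈⟨ ∏-positions-suc (monomial α) m ⟨
    ∏ (monomial α) (positions n) ∎
    where
    α = zipcons (iota 1 n) β
    len′ : length β ≤ length (iota 1 n)
    len′ = ≡.subst₂ _≤_ (≡.sym len) (≡.sym (length-iota 1 n)) (ℕₚ.n≤1+n m)

  term : Array → Carrier
  term α = (pow R t (E n α) * pow R (1# + t) (N n α)) * ∏ (λ k → pow R (x k) (C n α k ∸ 1)) indices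

  -- Membership in `Y`, the powers of t and 1 + t, and the monomial are all products over positions,
  -- so they can be multiplied position by position.
  term-weight : ∀ β → length β ≡ m → let α = zipcons (iota 1 n) β in
    ind (isY n α) * term α ≈ weight n α
  term-weight β len = begin
    ind (isY n α) * term α
      ≈⟨ *-cong
           (trans (ind-and (condAt α) ps) (trans (∏-cong (ind-condAt α) ps) (∏-∙ (frame α) (southwest α) ps)))
           (*-cong (*-cong (pow-countᵇ t (isE α) ps) (pow-countᵇ (1# + t) (isN α) ps)) (∏-monomial β len)) ⟩
    (∏ (frame α) ps * ∏ (southwest α) ps) * ((∏ es ps * ∏ ns ps) * ∏ (monomial α) ps)
      ≈⟨ *-assoc _ _ _ ⟩
    ∏ (frame α) ps * (∏ (southwest α) ps * ((∏ es ps * ∏ ns ps) * ∏ (monomial α) ps))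
      ≈⟨ *-congˡ (*-congˡ (trans (*-congʳ (sym (∏-∙ es ns ps))) (sym (∏-∙ _ (monomial α) ps)))) ⟩
    ∏ (frame α) ps * (∏ (southwest α) ps * ∏ (λ p → (es p * ns p) * monomial α p) ps)
      ≈⟨ *-congˡ (∏-∙ (southwest α) _ ps) ⟨
    ∏ (frame α) ps * ∏ (λ p → southwest α p * ((es p * ns p) * monomial α p)) ps
      ≈⟨ *-congˡ (∏-cong (turn-factors α) ps) ⟩
    weight n α ∎
    where
    α  = zipcons (iota 1 n) β
    ps = positions n
    es ns : ℕ × ℕ → Carrier
    es p = sel (isE α p) t
    ns p = sel (isN α p) (1# + t)

  ∑-filterᵇ : {A : Set} (p : A → Bool) (f : A → Carrier) → ∀ ys →
    ∑ f (filterᵇ p ys) ≈ ∑ (λ y → ind (p y) * f y) ys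
  ∑-filterᵇ p f []       = refl
  ∑-filterᵇ p f (y ∷ ys) with p y
  ... | true  = +-cong (sym (*-identityˡ _)) (∑-filterᵇ p f ys)
  ... | false = trans (∑-filterᵇ p f ys) (trans (sym (+-identityˡ _)) (+-congʳ (sym (zeroˡ _))))

  increasing-iota : ∀ s k → increasing (iota s k) ≡ true
  increasing-iota s zero          = ≡.refl
  increasing-iota s (suc zero)    = ≡.refl
  increasing-iota s (suc (suc k)) = ≡.cong₂ _∧_ (<ᵇ-suc s) (increasing-iota (suc s) (suc k))
    where
    <ᵇ-suc : ∀ s → (s <ᵇ suc s) ≡ true
    <ᵇ-suc zero    = ≡.refl
    <ᵇ-suc (suc s) = <ᵇ-suc s

  RHS≈alternant : RHS R n x t ≈ alternant (iota 1 n) (replicate n true)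
  RHS≈alternant = begin
    ∑ term (filterᵇ (isY n) (candidates n))
      ≈⟨ ∑-filterᵇ (isY n) term (candidates n) ⟩
    ∑ f (arraysFrom 1 n)
      ≡⟨ ≡.cong (∑ f) (arraysFrom≡arraysAt 1 n) ⟩
    ∑ f (arraysAt 1 0 n)
      ≈⟨ ∑-transpose f 1 0 m ⟩
    ∑ (λ c → ∑ (λ β → f (zipcons c β)) (arraysAt 1 1 m)) (colsAt 1 0 n)
      -- The first column is forced to be 1, ..., n.
      ≡⟨ ≡.cong (∑ _) (colsAt-0 1 n) ⟩
    ∑ (λ β → f (zipcons (iota 1 n) β)) (arraysAt 1 1 m) + 0#
      ≈⟨ +-identityʳ _ ⟩
    ∑ (λ β → f (zipcons (iota 1 n) β)) (arraysAt 1 1 m)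
      ≈⟨ ∑-arrays-cong 1 1 m term-weight ⟩
    ∑ (λ β → weight n (zipcons (iota 1 n) β)) (arraysAt 1 1 m)
      ≈⟨ weight-sum 0 m (column-iota 1 n) ℕₚ.≤-refl ⟩
    ind (increasing (iota 1 n)) * alternant (iota 1 n) (replicate n true)
      ≈⟨ trans (*-congʳ (reflexive (≡.cong ind (increasing-iota 1 n)))) (*-identityˡ _) ⟩
    alternant (iota 1 n) (replicate n true) ∎
    where
    f : Array → Carrier
    f α = ind (isY n α) * term α

  LHS≈staircase : LHS R n x t ≈ staircase n 1
  LHS≈staircase = begin
    LHS R n x t
      ≈⟨ ∏-concatMap-map _ (λ j i → i , j) (λ j → map suc (upTo (j ∸ 1))) (map suc (upTo n)) ⟩
    _ ≡⟨ ∏-map _ suc (upTo n) ⟩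
    -- All indices lie between 1 and n, where `X` agrees with `x`; the summand 0 is the `m` of
    -- `staircase-triangle`.
    _ ≈⟨ ∏-upTo-cong n (λ j j<n → trans (reflexive (∏-map _ suc (upTo j)))
           (∏-upTo-cong j (λ i i<j → +-cong (sym (X≈x i (ℕₚ.<-trans i<j j<n)))
             (*-congˡ (trans (sym (X≈x j j<n)) (reflexive (≡.cong (X ∘ suc) (≡.sym (ℕₚ.+-identityʳ j)))))))))
       ⟩
    ∏ (λ j → ∏ (λ i → X (suc i) + t * X (suc j ℕ.+ 0)) (upTo j)) (upTo n)
      ≈⟨ staircase-triangle n 0 ⟨
    staircase n 1 ∎

theorem18 : ∀ {c ℓ} (R : CommutativeRing c ℓ) (n : ℕ) → 1 ≤ n →
    (x : ℕ → CommutativeRing.Carrier R) (t : CommutativeRing.Carrier R) →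
    CommutativeRing._≈_ R (LHS R n x t) (RHS R n x t)
theorem18 R (suc m) _ x t = begin
  LHS R n x t                             ≈⟨ LHS≈staircase ⟩
  staircase n 1                           ≈⟨ wedges-staircase n 1 (ℕₚ.≤-reflexive (ℕₚ.+-comm n 1)) ⟨
  alternant (iota 1 n) (replicate n true) ≈⟨ RHS≈alternant ⟨
  RHS R n x t                             ∎
  where
  open CommutativeRing R using (setoid)
  open Expansion R x t m
  open Alternants R X t n using (staircase; alternant; wedges-staircase)
  open SetoidReasoning setoid
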